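{- Fix integers $m,n\ge 1$, the directed grid $G_{m,n}$ with source $s=(0,0)$ and sink $t=(m,n)$, a slope $a>0$ and a demand $q>0$. Call a chord $u\to v$ Braess-capable if there exist $b,c,d\ge 0$ such that, if every grid edge has latency $ax+b$ and the chord has latency $cx+d$, the resulting Braess Ratio exceeds $1$. Then a chord $u\to v$ is Braess-capable if and only if \[ V_{uv}<0\qquad\text{and}\qquad k>0 , \] where $k=\lambda(v)-\lambda(u)$ is the level gain of the chord.
   Context: Grid: $G_{m,n}=(V,E)$ is the directed graph with vertex set $V=\{0,\dots,m\}\times\{0,\dots,n\}$ and directed edges $(i,j)\to(i+1,j)$ for $i<m$ and $(i,j)\to(i,j+1)$ for $j<n$. Chord: an added directed edge $u\to v$ with $u,v\in V$, $u\ne v$, such that $uv$ is not an edge of the underlying undirected grid. The level of a vertex is $\lambda(i,j)=i+j$. Feasible flow (in the grid, or in the grid plus chord): a nonnegative number $f_e$ for each directed edge $e$, with flow conserved at every vertex other than $s,t$, and net outflow from $s$ and net inflow to $t$ both equal to $q$. Its cost is $C(f)=\sum_e f_e\ell_e(f_e)$, where $\ell_e$ is the latency function of $e$. User Equilibrium: a feasible flow, decomposable into flows along $s$-$t$ paths, such that every path carrying positive flow has latency (sum of $\ell_e(f_e)$ over its edges) no larger than that of any other $s$-$t$ path. By a classical theorem (Beckmann, McGuire, Winsten) these are exactly the minimizers over feasible flows of the Beckmann potential $Z(f)=\sum_e\int_0^{f_e}\ell_e(y)\,dy$; in the networks considered here the minimizer is unique. Braess Ratio: $BR=C_{\mathrm{new}}/C_{\mathrm{old}}$,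 where $C_{\mathrm{old}}$ is the cost of the User Equilibrium of $G_{m,n}$ and $C_{\mathrm{new}}$ is the cost of the User Equilibrium of $G_{m,n}$ with the chord added (same $s,t,q$). Electrical quantities: $\mathsf L$ is the weighted graph Laplacian of the underlying undirected grid in which every edge has resistance $a$ (diagonal entries $\deg/a$, off-diagonal entries $-1/a$ for adjacent vertices and $0$ otherwise), $\mathsf L^+$ is its Moore--Penrose pseudoinverse, $\mathbf e_w\in\mathbb R^{V}$ is the standard basis vector at $w$, and $V_{uv}=q(\mathbf e_s-\mathbf e_t)^{\mathsf T}\mathsf L^+(\mathbf e_u-\mathbf e_v)$. -}

module Defs where

open import Level using (0ℓ)
open import Algebra.Bundles using (CommutativeRing)
open import Algebra.Definitions.RawMonoid using () renaming (_×_ to multiple)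
open import Data.Bool using (if_then_else_)
open import Data.Fin using (Fin; zero; suc; inject₁; fromℕ; toℕ)
import Data.Fin.Properties as Fin
open import Data.Integer using (ℤ; _⊖_)
open import Data.List using (List; []; _∷_; _++_; map; foldr; filter; length; allFin; cartesianProduct)
open import Data.List.Relation.Unary.All using (All)
open import Data.List.Relation.Unary.Any using (Any; any?)
open import Data.List.Relation.Unary.Unique.Propositional using (Unique)
import Data.List.Membership.DecPropositional as Membership
open import Data.Maybe using (Maybe; just; nothing; maybe)
import Data.Maybe.Properties as Maybe
open import Data.Nat as ℕ using (ℕ; suc)
open import Data.Product using (Σ-syntax; ∃-syntax; _×_; _,_; proj₁; proj₂)
import Data.Product.Properties as Product
open import Data.Sum using (_⊎_; inj₁; inj₂; [_,_]′)
import Data.Sum.Properties as Sum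
open import Relation.Binary using (Rel; Decidable; DecidableEquality; IsStrictTotalOrder)
import Relation.Binary.Construct.StrictToNonStrict as StrictToNonStrict
open import Relation.Binary.PropositionalEquality using (_≡_; _≢_)
open import Relation.Nullary using (¬_; does)
open import Relation.Nullary.Decidable using (_×-dec_; _⊎-dec_)

-- The real numbers, axiomatised as a Dedekind-complete ordered field.
record Reals : Set₁ where
  infix  4 _<_
  infixl 7 _/_
  infix  8 _⁻¹

  field
    commutativeRing : CommutativeRing 0ℓ 0ℓ

  open CommutativeRing commutativeRing public

  field
    _<_                : Rel Carrier 0ℓ
    isStrictTotalOrder : IsStrictTotalOrder _≈_ _<_
    0<1                : 0# < 1#
    +-monoˡ-<          : ∀ {x y} z → x < y → x + z < y + z
    *-pos              : ∀ {x y} → 0# < x → 0# < y → 0# < x * y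
    -- Total for convenience; nothing is assumed about the value at 0.
    _⁻¹                : Carrier → Carrier
    ⁻¹-inverseʳ        : ∀ {x} → ¬ (x ≈ 0#) → x * x ⁻¹ ≈ 1#

  open StrictToNonStrict _≈_ _<_ public using (_≤_)

  UpperBound : (Carrier → Set) → Carrier → Set
  UpperBound P b = ∀ x → P x → x ≤ b

  field
    supremum : (P : Carrier → Set) → ∃[ x ] P x → ∃[ b ] UpperBound P b →
               ∃[ s ] (UpperBound P s × (∀ b → UpperBound P b → s ≤ b))

  _/_ : Carrier → Carrier → Carrier
  x / y = x * y ⁻¹

  fromNat : ℕ → Carrier
  fromNat n = multiple +-rawMonoid n 1#

  ∑ : {A : Set} → List A → (A → Carrier) → Carrier
  ∑ xs f = foldr (λ x r → f x + r) 0# xs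

  infixr 5 ∑
  syntax ∑ xs (λ x → e) = ∑[ x ← xs ] e

module Grid (m n : ℕ) where

  Vertex : Set
  Vertex = Fin (suc m) × Fin (suc n)

  -- inj₁ (i , j) is the edge (i,j) → (i+1,j); inj₂ (i , j) is (i,j) → (i,j+1).
  GridEdge : Set
  GridEdge = (Fin m × Fin (suc n)) ⊎ (Fin (suc m) × Fin n)

  gridTail gridHead : GridEdge → Vertex
  gridTail (inj₁ (i , j)) = inject₁ i , j
  gridTail (inj₂ (i , j)) = i , inject₁ j
  gridHead (inj₁ (i , j)) = suc i , j
  gridHead (inj₂ (i , j)) = i , suc j

  vertices : List Vertex
  vertices = cartesianProduct (allFin (suc m)) (allFin (suc n))

  gridEdges : List GridEdge
  gridEdges = map inj₁ (cartesianProduct (allFin m) (allFin (suc n)))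
           ++ map inj₂ (cartesianProduct (allFin (suc m)) (allFin n))

  s t : Vertex
  s = zero , zero
  t = fromℕ m , fromℕ n

  infix 4 _≟ᵥ_ _≟ₑ_

  _≟ᵥ_ : DecidableEquality Vertex
  _≟ᵥ_ = Product.≡-dec Fin._≟_ Fin._≟_

  _≟ₑ_ : DecidableEquality GridEdge
  _≟ₑ_ = Sum.≡-dec (Product.≡-dec Fin._≟_ Fin._≟_) (Product.≡-dec Fin._≟_ Fin._≟_)

  Adjacent : Rel Vertex 0ℓ
  Adjacent x y = Any (λ e → (gridTail e ≡ x × gridHead e ≡ y)
                          ⊎ (gridTail e ≡ y × gridHead e ≡ x)) gridEdges

  adjacent? : Decidable Adjacent
  adjacent? x y = any? (λ e → ((gridTail e ≟ᵥ x) ×-dec (gridHead e ≟ᵥ y))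
                        ⊎-dec ((gridTail e ≟ᵥ y) ×-dec (gridHead e ≟ᵥ x))) gridEdges

  degree : Vertex → ℕ
  degree x = length (filter (adjacent? x) vertices)

  IsChord : Rel Vertex 0ℓ
  IsChord u v = u ≢ v × ¬ Adjacent u v

  level : Vertex → ℕ
  level (i , j) = toℕ i ℕ.+ toℕ j

  levelGain : Vertex → Vertex → ℤ
  levelGain u v = level v ⊖ level u

module Flow (ℝ : Reals) where
  open Reals ℝ

  record Network : Set₁ where
    field
      Vertex Edge   : Set
      _≟ᵥ_          : DecidableEquality Vertex
      _≟ₑ_          : DecidableEquality Edge
      edges         : List Edge   -- lists every edge exactly once
      tail head     : Edge → Vertex
      source target : Vertex
      latency       : Edge → Carrier → Carrier

  module Equilibrium (N : Network) (q : Carrier) where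
    open Network N
    open Membership _≟ₑ_ using (_∈?_)

    outflow inflow : (Edge → Carrier) → Vertex → Carrier
    outflow f x = ∑[ e ← filter (λ e → tail e ≟ᵥ x) edges ] f e
    inflow  f x = ∑[ e ← filter (λ e → head e ≟ᵥ x) edges ] f e

    record IsFeasible (f : Edge → Carrier) : Set where
      field
        nonnegative  : ∀ e → 0# ≤ f e
        conservation : ∀ x → x ≢ source → x ≢ target → inflow f x ≈ outflow f x
        sourceSupply : outflow f source - inflow f source ≈ q
        targetDemand : inflow f target - outflow f target ≈ q

    cost : (Edge → Carrier) → Carrier
    cost f = ∑[ e ← edges ] f e * latency e (f e)

    IsWalk : Vertex → List Edge → Vertex → Set
    IsWalk x []       y = x ≡ y
    IsWalk x (e ∷ es) y = tail e ≡ x × IsWalk (head e) es y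

    record Path : Set where
      field
        route   : List Edge
        isWalk  : IsWalk source route target
        simple  : Unique (source ∷ map head route)

    open Path public using (route)

    pathLatency : (Edge → Carrier) → Path → Carrier
    pathLatency f P = ∑[ e ← route P ] latency e (f e)

    -- Finitely many paths, each with the amount of flow sent along it.
    PathFlow : Set
    PathFlow = List (Path × Carrier)

    edgeFlow : PathFlow → Edge → Carrier
    edgeFlow D e = ∑[ Ph ← D ] (if does (e ∈? route (proj₁ Ph)) then proj₂ Ph else 0#)

    record IsDecomposition (D : PathFlow) (f : Edge → Carrier) : Set where
      field
        nonnegative : All (λ Ph → 0# ≤ proj₂ Ph) D
        sumsTo      : ∀ e → edgeFlow D e ≈ f e

    IsUserEquilibrium : (Edge → Carrier) → Set
    IsUserEquilibrium f =
      IsFeasible f ×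
      Σ[ D ∈ PathFlow ] IsDecomposition D f ×
        All (λ Ph → 0# < proj₂ Ph → ∀ P′ → pathLatency f (proj₁ Ph) ≤ pathLatency f P′) D

  module _ (m n : ℕ) where
    open Grid m n

    affine : Carrier → Carrier → Carrier → Carrier
    affine slope intercept x = slope * x + intercept

    gridNetwork : (a b : Carrier) → Network
    gridNetwork a b = record
      { Vertex = Vertex ; Edge = GridEdge ; _≟ᵥ_ = _≟ᵥ_ ; _≟ₑ_ = _≟ₑ_
      ; edges = gridEdges ; tail = gridTail ; head = gridHead
      ; source = s ; target = t
      ; latency = λ _ → affine a b
      }

    -- The edge `nothing` is the chord u → v.
    chordNetwork : (a b c d : Carrier) (u v : Vertex) → Network
    chordNetwork a b c d u v = record
      { Vertex = Vertex ; Edge = Maybe GridEdge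
      ; _≟ᵥ_ = _≟ᵥ_ ; _≟ₑ_ = Maybe.≡-dec _≟ₑ_
      ; edges = nothing ∷ map just gridEdges
      ; tail = maybe gridTail u ; head = maybe gridHead v
      ; source = s ; target = t
      ; latency = maybe (λ _ → affine a b) (affine c d)
      }

    -- r is the Braess Ratio C_new / C_old.  User equilibria of both networks
    -- exist and are unique, so naming them existentially determines r.
    IsBraessRatio : (a b c d q : Carrier) (u v : Vertex) → Carrier → Set
    IsBraessRatio a b c d q u v r =
      ∃[ f ] ∃[ g ] (Old.IsUserEquilibrium f × New.IsUserEquilibrium g ×
                     r ≈ New.cost g / Old.cost f)
      where
      module Old = Equilibrium (gridNetwork a b) q
      module New = Equilibrium (chordNetwork a b c d u v) q

    BraessCapable : (a q : Carrier) (u v : Vertex) → Set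
    BraessCapable a q u v =
      ∃[ b ] ∃[ c ] ∃[ d ] (0# ≤ b × 0# ≤ c × 0# ≤ d ×
        ∃[ r ] (IsBraessRatio a b c d q u v r × 1# < r))

    Matrix : Set
    Matrix = Vertex → Vertex → Carrier

    infix  4 _≋_
    infixl 7 _⊗_
    infix  8 _ᵀ

    _≋_ : Rel Matrix 0ℓ
    A ≋ B = ∀ x y → A x y ≈ B x y

    _⊗_ : Matrix → Matrix → Matrix
    (A ⊗ B) x y = ∑[ z ← vertices ] A x z * B z y

    _ᵀ : Matrix → Matrix
    (A ᵀ) x y = A y x

    record IsMoorePenroseInverse (A X : Matrix) : Set where
      field
        AXA≋A        : A ⊗ X ⊗ A ≋ A
        XAX≋X        : X ⊗ A ⊗ X ≋ X
        AX-symmetric : (A ⊗ X) ᵀ ≋ A ⊗ X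
        XA-symmetric : (X ⊗ A) ᵀ ≋ X ⊗ A

    laplacian : Carrier → Matrix
    laplacian a x y =
      if does (x ≟ᵥ y) then fromNat (degree x) / a
      else if does (adjacent? x y) then - (1# / a)
      else 0#

    basis : Vertex → Vertex → Carrier
    basis w x = if does (w ≟ᵥ x) then 1# else 0#

    voltage : (L⁺ : Matrix) (q : Carrier) (u v : Vertex) → Carrier
    voltage L⁺ q u v =
      q * (∑[ x ← vertices ] ∑[ y ← vertices ]
             (basis s x - basis t x) * L⁺ x y * (basis u y - basis v y))

-- In the grid all s-t paths have the same length, so the old equilibrium is the electric flow f₀ with
-- potential φ; it is positive on every edge because the horizontal and the vertical drops of φ are
-- superharmonic with zero (respectively reflecting) boundary values.
--
-- (⇒) Let g be the new equilibrium on the grid edges and y its flow on the chord.  Optimality of the new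
-- equilibrium against f₀ gives a⟨g, f₀⟩ + b∑f₀ ≥ C_new > C_old = a⟨f₀, f₀⟩ + b∑f₀, while
-- a⟨f₀, f₀⟩ − a⟨g, f₀⟩ = y V since a f₀ is a gradient; hence y V < 0.  Combining the same inequality
-- with ‖f₀ − g‖² ≥ 0 and ∑f₀ − ∑g = y k yields b y k ≥ −y V > 0, hence k > 0.
--
-- (⇐) With ψ the potential of a unit current from u to v, f₀ − ε∇ψ/a stays nonnegative for small ε > 0.
-- For c = d = 0 and b = (−V + ε(ψ(u) − ψ(v)))/k, this flow together with ε on the chord makes every latency
-- a potential difference, so it is an equilibrium; its cost exceeds the old one by −ε V.

module Submission where

open import Defs
open import Level using (0ℓ)
open import Algebra.Bundles using (RawRing)
import Algebra.Properties.Ring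
import Algebra.Properties.Semiring.Mult.TCOptimised
import Algebra.Solver.Ring
open import Algebra.Solver.Ring.AlmostCommutativeRing using (fromCommutativeRing; _-Raw-AlmostCommutative⟶_)
open import Data.Bool using (if_then_else_)
open import Data.Fin as Fin using (Fin; zero; suc; inject₁; fromℕ; fromℕ<; toℕ)
import Data.Fin.Properties as Fin
open import Data.Integer as ℤ using (ℤ; +_; -[1+_]; _⊖_; 0ℤ)
import Data.Integer.Properties as ℤ
open import Data.List using (List; []; _∷_; _++_; map; filter; cartesianProduct; length; allFin; upTo)
import Data.List.Properties as List
import Data.List.Membership.DecPropositional as Membership
open import Data.List.Membership.Propositional using (_∈_; find)
open import Data.List.Membership.Propositional.Properties
  using (∈-++⁺ˡ; ∈-++⁺ʳ; ∈-map⁺; ∈-map⁻; ∈-cartesianProduct⁺; ∈-cartesianProduct⁻; ∈-allFin; ∈-upTo⁺; ∈-upTo⁻)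
open import Data.List.Relation.Unary.All as All using (All; []; _∷_)
import Data.List.Relation.Unary.All.Properties as All
open import Data.List.Relation.Unary.AllPairs as AllPairs using ([]; _∷_)
import Data.List.Relation.Unary.AllPairs.Properties as AllPairs
open import Data.List.Relation.Unary.Any as Any using (here; there; any?)
open import Data.List.Relation.Unary.Unique.Propositional using (Unique)
import Data.List.Relation.Unary.Unique.Propositional.Properties as Unique
open import Data.Maybe using (Maybe; just; nothing)
import Data.Maybe.Properties as Maybe
open import Data.Nat as ℕ using (ℕ; zero; suc; z≤n; s≤s)
import Data.Nat.Properties as ℕ
open import Data.Product using (∃-syntax; _×_; _,_; proj₁; proj₂)
import Data.Product.Properties as Product
open import Data.Sum using (_⊎_; inj₁; inj₂; [_,_]′)
import Data.Sum.Properties as Sum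
open import Function.Bundles using (_⇔_; mk⇔)
open import Relation.Binary using (StrictTotalOrder; DecTotalOrder; tri<; tri≈; tri>)
import Relation.Binary.Properties.StrictTotalOrder
import Relation.Binary.Reasoning.Setoid
import Relation.Binary.Reasoning.StrictPartialOrder
open import Relation.Binary.PropositionalEquality as ≡ using (_≡_; _≢_)
open import Relation.Nullary using (¬_; Dec; yes; no; does; contradiction)
open import Relation.Nullary.Decidable using (_×-dec_; _⊎-dec_)
open import Relation.Unary using (Decidable)

-- Equilibria are defined through explicit decompositions into simple paths, and this shapes both
-- directions. Decompositions are constructed only where the level rises strictly along every edge,
-- so that no walk repeats a vertex: in the grid, and in the grid with a chord of positive level
-- gain. For (⇒) the chord may close a directed cycle; in the new network that direction relies on
-- the decomposition that the given equilibrium carries, along whose paths potential differences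
-- telescope.
--
-- The value of `b` in (⇐) solves one equation. The drop of the new potential across the chord is
-- `V - ε * R + b * k`, with `R` the effective resistance between `u` and `v`; equating it to the
-- zero latency of the chord gives `b`. It is nonnegative since `V` is negative and `R` is an
-- energy. Strict positivity of `f₀` leaves room for a small current of either sign on each edge.
--
-- The potentials come from an `L⁺` known only through the four Penrose equations. Connectedness of
-- the grid confines the kernel of the Laplacian to the constants, and these cancel in every dipole.

-- Ring identities over the reals with integer coefficients.

module IntegerRingSolver (ℝ : Reals) where
  open Reals ℝ hiding (zero)
  open Algebra.Properties.Ring ring
  open Algebra.Properties.Semiring.Mult.TCOptimised semiring using (1+×; ×-homo-+; ×1-homo-*) renaming (_×_ to _·_)
  open import Relation.Binary.Reasoning.Setoid setoid

  private
    -- The multiple `_·_` is the one for which `1 · 1#` computes to `1#`, so the constants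
    -- `con (+ 0)` and `con (+ 1)` evaluate to `0#` and `1#` themselves.
    ι : ℤ → Carrier
    ι (+ n)    = n · 1#
    ι -[1+ n ] = - (suc n · 1#)

    ι-⊖ : ∀ m n → ι (m ⊖ n) ≈ m · 1# - n · 1#
    ι-⊖ m zero = begin
      ι (m ⊖ 0)       ≡⟨ ≡.cong ι (ℤ.⊖-≥ {m} {0} ℕ.z≤n) ⟩
      m · 1#          ≈⟨ +-identityʳ _ ⟨
      m · 1# + 0#     ≈⟨ +-congˡ -0#≈0# ⟨
      m · 1# - 0#     ∎
    ι-⊖ zero    (suc n) = sym (+-identityˡ _)
    ι-⊖ (suc m) (suc n) = begin
      ι (suc m ⊖ suc n)                    ≡⟨ ≡.cong ι (ℤ.[1+m]⊖[1+n]≡m⊖n m n) ⟩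
      ι (m ⊖ n)                            ≈⟨ ι-⊖ m n ⟩
      m · 1# - n · 1#                      ≈⟨ +-congʳ (+-identityˡ _) ⟨
      0# + m · 1# - n · 1#                 ≈⟨ +-congʳ (+-congʳ (-‿inverseʳ 1#)) ⟨
      1# - 1# + m · 1# - n · 1#            ≈⟨ +-congʳ (+-assoc _ _ _) ⟩
      1# + (- 1# + m · 1#) - n · 1#        ≈⟨ +-congʳ (+-congˡ (+-comm _ _)) ⟩
      1# + (m · 1# - 1#) - n · 1#          ≈⟨ +-congʳ (+-assoc _ _ _) ⟨
      1# + m · 1# - 1# - n · 1#            ≈⟨ +-assoc _ _ _ ⟩
      1# + m · 1# + (- 1# - n · 1#)        ≈⟨ +-congˡ (-‿+-comm _ _) ⟩
      1# + m · 1# - (1# + n · 1#)          ≈⟨ +-cong (1+× m 1#) (-‿cong (1+× n 1#)) ⟨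
      suc m · 1# - suc n · 1#              ∎

    ι-+ : ∀ i j → ι (i ℤ.+ j) ≈ ι i + ι j
    ι-+ (+ m)    (+ n)    = ×-homo-+ 1# m n
    ι-+ (+ m)    -[1+ n ] = ι-⊖ m (suc n)
    ι-+ -[1+ m ] (+ n)    = trans (ι-⊖ n (suc m)) (+-comm _ _)
    ι-+ -[1+ m ] -[1+ n ] = begin
      - (suc (suc (m ℕ.+ n)) · 1#)     ≡⟨ ≡.cong (λ k → - (suc k · 1#)) (ℕ.+-suc m n) ⟨
      - ((suc m ℕ.+ suc n) · 1#)       ≈⟨ -‿cong (×-homo-+ 1# (suc m) (suc n)) ⟩
      - (suc m · 1# + suc n · 1#)      ≈⟨ -‿+-comm _ _ ⟨
      - (suc m · 1#) - suc n · 1#      ∎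

    ι-neg : ∀ i → ι (ℤ.- i) ≈ - ι i
    ι-neg (+ zero)  = sym -0#≈0#
    ι-neg (+ suc n) = refl
    ι-neg -[1+ n ]  = sym (-‿involutive _)

    ι-*⁺ : ∀ m j → ι (+ m ℤ.* j) ≈ m · 1# * ι j
    ι-*⁺ m (+ n) = begin
      ι (+ m ℤ.* + n)       ≡⟨ ≡.cong ι (ℤ.pos-* m n) ⟨
      (m ℕ.* n) · 1#        ≈⟨ ×1-homo-* m n ⟩
      m · 1# * n · 1#       ∎
    ι-*⁺ m -[1+ n ] = begin
      ι (+ m ℤ.* -[1+ n ])        ≡⟨ ≡.cong ι (ℤ.neg-distribʳ-* (+ m) (+ suc n)) ⟨
      ι (ℤ.- (+ m ℤ.* + suc n))   ≈⟨ ι-neg (+ m ℤ.* + suc n) ⟩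
      - ι (+ m ℤ.* + suc n)       ≈⟨ -‿cong (ι-*⁺ m (+ suc n)) ⟩
      - (m · 1# * suc n · 1#)     ≈⟨ -‿distribʳ-* _ _ ⟩
      m · 1# * - (suc n · 1#)     ∎

    ι-* : ∀ i j → ι (i ℤ.* j) ≈ ι i * ι j
    ι-* (+ m)    j = ι-*⁺ m j
    ι-* -[1+ m ] j = begin
      ι (-[1+ m ] ℤ.* j)          ≡⟨ ≡.cong ι (ℤ.neg-distribˡ-* (+ suc m) j) ⟨
      ι (ℤ.- (+ suc m ℤ.* j))     ≈⟨ ι-neg (+ suc m ℤ.* j) ⟩
      - ι (+ suc m ℤ.* j)         ≈⟨ -‿cong (ι-*⁺ (suc m) j) ⟩
      - (suc m · 1# * ι j)        ≈⟨ -‿distribˡ-* _ _ ⟩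
      - (suc m · 1#) * ι j        ∎

    ℤ-rawRing : RawRing 0ℓ 0ℓ
    ℤ-rawRing = record
      { Carrier = ℤ ; _≈_ = _≡_ ; _+_ = ℤ._+_ ; _*_ = ℤ._*_ ; -_ = ℤ.-_ ; 0# = + 0 ; 1# = + 1 }

    homomorphism : ℤ-rawRing -Raw-AlmostCommutative⟶ fromCommutativeRing commutativeRing
    homomorphism = record
      { ⟦_⟧ = ι ; +-homo = ι-+ ; *-homo = ι-* ; -‿homo = ι-neg ; 0-homo = refl ; 1-homo = refl }

    -- Comparing integers computes, whereas comparing abstract reals does not; this is what lets the
    -- solver cancel terms.
    ι-≟ : ∀ i j → Maybe (ι i ≈ ι j)
    ι-≟ i j with i ℤ.≟ j
    ... | yes i≡j = just (reflexive (≡.cong ι i≡j))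
    ... | no  _   = nothing

  open Algebra.Solver.Ring ℤ-rawRing (fromCommutativeRing commutativeRing) homomorphism ι-≟ public
    using (solve; con; _:+_; _:*_; _:-_; :-_; _:=_; Polynomial)

-- Consequences of the ordered field axioms.

module OrderedField (ℝ : Reals) where
  open Reals ℝ hiding (zero)
  open IntegerRingSolver ℝ

  strictTotalOrder : StrictTotalOrder _ _ _
  strictTotalOrder = record { isStrictTotalOrder = isStrictTotalOrder }

  open StrictTotalOrder strictTotalOrder public
    using (compare; strictPartialOrder; _<?_; _≟_; <-respʳ-≈; <-respˡ-≈)
    renaming (irrefl to <-irrefl; trans to <-trans; asym to <-asym)

  open DecTotalOrder (Relation.Binary.Properties.StrictTotalOrder.decTotalOrder strictTotalOrder) public
    using (antisym; _≤?_; ≤-respʳ-≈; ≤-respˡ-≈)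
    renaming (refl to ≤-refl; reflexive to ≤-reflexive; trans to ≤-trans; total to ≤-total)

  module ≈-Reasoning = Relation.Binary.Reasoning.Setoid setoid
  module ≤-Reasoning = Relation.Binary.Reasoning.StrictPartialOrder strictPartialOrder

  <⇒≤ : ∀ {x y} → x < y → x ≤ y
  <⇒≤ = inj₁

  ≮⇒≥ : ∀ {x y} → ¬ (x < y) → y ≤ x
  ≮⇒≥ {x} {y} x≮y with compare x y
  ... | tri< x<y _   _   = contradiction x<y x≮y
  ... | tri≈ _   x≈y _   = inj₂ (sym x≈y)
  ... | tri> _   _   y<x = inj₁ y<x

  ≤⇒≯ : ∀ {x y} → x ≤ y → ¬ (y < x)
  ≤⇒≯ (inj₁ x<y) y<x = <-asym x<y y<x
  ≤⇒≯ (inj₂ x≈y) y<x = <-irrefl (sym x≈y) y<x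

  <-≤-trans : ∀ {x y z} → x < y → y ≤ z → x < z
  <-≤-trans x<y (inj₁ y<z) = <-trans x<y y<z
  <-≤-trans x<y (inj₂ y≈z) = <-respʳ-≈ y≈z x<y

  ≤-<-trans : ∀ {x y z} → x ≤ y → y < z → x < z
  ≤-<-trans (inj₁ x<y) y<z = <-trans x<y y<z
  ≤-<-trans (inj₂ x≈y) y<z = <-respˡ-≈ (sym x≈y) y<z

  +-monoˡ-≤ : ∀ {x y} z → x ≤ y → x + z ≤ y + z
  +-monoˡ-≤ z (inj₁ x<y) = inj₁ (+-monoˡ-< z x<y)
  +-monoˡ-≤ z (inj₂ x≈y) = inj₂ (+-congʳ x≈y)

  +-mono-≤ : ∀ {x y z w} → x ≤ y → z ≤ w → x + z ≤ y + w
  +-mono-≤ {x} {y} {z} {w} x≤y z≤w = begin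
    x + z ≤⟨ +-monoˡ-≤ z x≤y ⟩
    y + z ≈⟨ +-comm y z ⟩
    z + y ≤⟨ +-monoˡ-≤ y z≤w ⟩
    w + y ≈⟨ +-comm w y ⟩
    y + w ∎
    where open ≤-Reasoning

  +-mono-<-≤ : ∀ {x y z w} → x < y → z ≤ w → x + z < y + w
  +-mono-<-≤ {x} {y} {z} {w} x<y z≤w = begin-strict
    x + z <⟨ +-monoˡ-< z x<y ⟩
    y + z ≤⟨ +-mono-≤ ≤-refl z≤w ⟩
    y + w ∎
    where open ≤-Reasoning

  x<y⇒0<y-x : ∀ {x y} → x < y → 0# < y - x
  x<y⇒0<y-x {x} {y} x<y = <-respˡ-≈ (-‿inverseʳ x) (+-monoˡ-< (- x) x<y)

  0<y-x⇒x<y : ∀ {x y} → 0# < y - x → x < y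
  0<y-x⇒x<y {x} {y} p = begin-strict
    x          ≈⟨ +-identityˡ x ⟨
    0# + x     <⟨ +-monoˡ-< x p ⟩
    y - x + x  ≈⟨ solve 2 (λ x y → y :- x :+ x := y) refl x y ⟩
    y          ∎
    where open ≤-Reasoning

  x≤y⇒0≤y-x : ∀ {x y} → x ≤ y → 0# ≤ y - x
  x≤y⇒0≤y-x {x} {y} x≤y = ≤-respˡ-≈ (-‿inverseʳ x) (+-monoˡ-≤ (- x) x≤y)

  0≤y-x⇒x≤y : ∀ {x y} → 0# ≤ y - x → x ≤ y
  0≤y-x⇒x≤y (inj₁ p) = inj₁ (0<y-x⇒x<y p)
  0≤y-x⇒x≤y {x} {y} (inj₂ p) = inj₂ (begin
    x          ≈⟨ +-identityˡ x ⟨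
    0# + x     ≈⟨ +-congʳ p ⟩
    y - x + x  ≈⟨ solve 2 (λ x y → y :- x :+ x := y) refl x y ⟩
    y          ∎)
    where open ≈-Reasoning

  0<-x⇒x<0 : ∀ {x} → 0# < - x → x < 0#
  0<-x⇒x<0 {x} p = 0<y-x⇒x<y (<-respʳ-≈ (sym (+-identityˡ (- x))) p)

  x<0⇒0<-x : ∀ {x} → x < 0# → 0# < - x
  x<0⇒0<-x {x} p = <-respʳ-≈ (+-identityˡ (- x)) (x<y⇒0<y-x p)

  +-pos-nonneg : ∀ {x y} → 0# < x → 0# ≤ y → 0# < x + y
  +-pos-nonneg 0<x 0≤y = <-respˡ-≈ (+-identityˡ 0#) (+-mono-<-≤ 0<x 0≤y)

  +-nonneg : ∀ {x y} → 0# ≤ x → 0# ≤ y → 0# ≤ x + y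
  +-nonneg 0≤x 0≤y = ≤-respˡ-≈ (+-identityˡ 0#) (+-mono-≤ 0≤x 0≤y)

  *-nonneg : ∀ {x y} → 0# ≤ x → 0# ≤ y → 0# ≤ x * y
  *-nonneg (inj₁ 0<x) (inj₁ 0<y) = inj₁ (*-pos 0<x 0<y)
  *-nonneg {x} {y} (inj₂ 0≈x) _  = inj₂ (trans (sym (zeroˡ y)) (*-congʳ 0≈x))
  *-nonneg {x} {y} _ (inj₂ 0≈y)  = inj₂ (trans (sym (zeroʳ x)) (*-congˡ 0≈y))

  *-monoˡ-≤ : ∀ {c x y} → 0# ≤ c → x ≤ y → c * x ≤ c * y
  *-monoˡ-≤ {c} {x} {y} 0≤c x≤y = 0≤y-x⇒x≤y (≤-respʳ-≈
    (solve 3 (λ c x y → c :* (y :- x) := c :* y :- c :* x) refl c x y)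
    (*-nonneg 0≤c (x≤y⇒0≤y-x x≤y)))

  -- The contrapositive of `*-monoˡ-≤`, hence available for a factor known only to be nonnegative,
  -- such as `b * y` in `gain-positive`.
  *-cancelˡ-< : ∀ {c x y} → 0# ≤ c → c * x < c * y → x < y
  *-cancelˡ-< {c} {x} {y} 0≤c cx<cy with x <? y
  ... | yes x<y = x<y
  ... | no  x≮y = contradiction cx<cy (≤⇒≯ (*-monoˡ-≤ 0≤c (≮⇒≥ x≮y)))

  square-nonneg : ∀ x → 0# ≤ x * x
  square-nonneg x with compare 0# x
  ... | tri< 0<x _   _ = inj₁ (*-pos 0<x 0<x)
  ... | tri≈ _ 0≈x _   = *-nonneg (inj₂ 0≈x) (inj₂ 0≈x)
  ... | tri> _   _ x<0 = inj₁ (<-respʳ-≈ (solve 1 (λ x → (:- x) :* (:- x) := x :* x) refl x)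
                                         (*-pos (x<0⇒0<-x x<0) (x<0⇒0<-x x<0)))

  x≉0⇒0<x² : ∀ {x} → ¬ (x ≈ 0#) → 0# < x * x
  x≉0⇒0<x² {x} x≉0 with compare 0# x
  ... | tri< 0<x _   _ = *-pos 0<x 0<x
  ... | tri≈ _ 0≈x _   = contradiction (sym 0≈x) x≉0
  ... | tri> _   _ x<0 = <-respʳ-≈ (solve 1 (λ x → (:- x) :* (:- x) := x :* x) refl x)
                                         (*-pos (x<0⇒0<-x x<0) (x<0⇒0<-x x<0))

  0<x⇒x≉0 : ∀ {x} → 0# < x → ¬ (x ≈ 0#)
  0<x⇒x≉0 0<x x≈0 = <-irrefl (sym x≈0) 0<x

  0<x⇒0<x⁻¹ : ∀ {x} → 0# < x → 0# < x ⁻¹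
  0<x⇒0<x⁻¹ {x} 0<x = *-cancelˡ-< (<⇒≤ 0<x) (begin-strict
    x * 0#    ≈⟨ zeroʳ x ⟩
    0#        <⟨ 0<1 ⟩
    1#        ≈⟨ ⁻¹-inverseʳ (0<x⇒x≉0 0<x) ⟨
    x * x ⁻¹  ∎)
    where open ≤-Reasoning

  x*[y/x]≈y : ∀ {x} → 0# < x → ∀ y → x * (y / x) ≈ y
  x*[y/x]≈y {x} 0<x y = begin
    x * (y * x ⁻¹) ≈⟨ solve 3 (λ x y z → x :* (y :* z) := x :* z :* y) refl x y (x ⁻¹) ⟩
    x * x ⁻¹ * y   ≈⟨ *-congʳ (⁻¹-inverseʳ (0<x⇒x≉0 0<x)) ⟩
    1# * y         ≈⟨ *-identityˡ y ⟩
    y              ∎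
    where open ≈-Reasoning

  fromNat-nonneg : ∀ k → 0# ≤ fromNat k
  fromNat-nonneg zero    = ≤-refl
  fromNat-nonneg (suc k) = +-nonneg (<⇒≤ 0<1) (fromNat-nonneg k)

  fromNat-mono-≤ : ∀ {k l} → k ℕ.≤ l → fromNat k ≤ fromNat l
  fromNat-mono-≤ {l = l} z≤n = fromNat-nonneg l
  fromNat-mono-≤ (s≤s k≤l) = +-mono-≤ ≤-refl (fromNat-mono-≤ k≤l)

  fromNat-mono-< : ∀ {k l} → k ℕ.< l → fromNat k < fromNat l
  fromNat-mono-< {k} k<l = <-≤-trans
    (<-respˡ-≈ (+-identityˡ _) (+-monoˡ-< (fromNat k) 0<1)) (fromNat-mono-≤ k<l)

-- Indicator functions and finite sums.

module Sums (ℝ : Reals) where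
  open Reals ℝ hiding (zero)
  open IntegerRingSolver ℝ
  open OrderedField ℝ

  private variable
    A B : Set
    P Q R : Set

  -- The Iverson bracket. The filters, conditionals and `basis` vectors of the definitions become
  -- factors inside sums, which can be exchanged and normalised.
  𝟙 : Dec P → Carrier
  𝟙 d = if does d then 1# else 0#

  𝟙-yes : (d : Dec P) → P → 𝟙 d ≈ 1#
  𝟙-yes (yes _) _ = refl
  𝟙-yes (no ¬p) p = contradiction p ¬p

  𝟙-no : (d : Dec P) → ¬ P → 𝟙 d ≈ 0#
  𝟙-no (yes p) ¬p = contradiction p ¬p
  𝟙-no (no _)  _  = refl

  𝟙-cong : (d : Dec P) (e : Dec Q) → (P → Q) → (Q → P) → 𝟙 d ≈ 𝟙 e
  𝟙-cong (yes p) e P⇒Q _   = sym (𝟙-yes e (P⇒Q p))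
  𝟙-cong (no ¬p) e _   Q⇒P = sym (𝟙-no e (λ q → ¬p (Q⇒P q)))

  𝟙-∧ : (d : Dec P) (e : Dec Q) (r : Dec R) → (R → P × Q) → (P → Q → R) → 𝟙 r ≈ 𝟙 d * 𝟙 e
  𝟙-∧ (yes p) (yes q) r _   to = trans (𝟙-yes r (to p q)) (sym (*-identityˡ 1#))
  𝟙-∧ (yes p) (no ¬q) r fro _  = trans (𝟙-no r (λ x → ¬q (proj₂ (fro x)))) (sym (zeroʳ 1#))
  𝟙-∧ (no ¬p) e       r fro _  = trans (𝟙-no r (λ x → ¬p (proj₁ (fro x)))) (sym (zeroˡ (𝟙 e)))

  𝟙-⊎ : (d : Dec P) (e : Dec Q) (r : Dec R) → (P → ¬ Q) → (R → P ⊎ Q) → (P ⊎ Q → R) → 𝟙 r ≈ 𝟙 d + 𝟙 e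
  𝟙-⊎ (yes p) (yes q) r dis _ _   = contradiction q (dis p)
  𝟙-⊎ (yes p) (no _)  r _   _ to  = trans (𝟙-yes r (to (inj₁ p))) (sym (+-identityʳ 1#))
  𝟙-⊎ (no _)  (yes q) r _   _ to  = trans (𝟙-yes r (to (inj₂ q))) (sym (+-identityˡ 1#))
  𝟙-⊎ (no ¬p) (no ¬q) r _ fro _   = trans (𝟙-no r (λ x → [ ¬p , ¬q ]′ (fro x))) (sym (+-identityˡ 0#))

  𝟙-nonneg : (d : Dec P) → 0# ≤ 𝟙 d
  𝟙-nonneg (yes _) = <⇒≤ 0<1
  𝟙-nonneg (no _)  = ≤-refl

  if≈𝟙* : (d : Dec P) (x : Carrier) → (if does d then x else 0#) ≈ 𝟙 d * x
  if≈𝟙* (yes _) x = sym (*-identityˡ x)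
  if≈𝟙* (no _)  x = sym (zeroˡ x)

  ∑-cong : (xs : List A) {f g : A → Carrier} → (∀ x → f x ≈ g x) → ∑ xs f ≈ ∑ xs g
  ∑-cong []       _   = refl
  ∑-cong (x ∷ xs) f≈g = +-cong (f≈g x) (∑-cong xs f≈g)

  ∑-zero : (xs : List A) {f : A → Carrier} → (∀ x → f x ≈ 0#) → ∑ xs f ≈ 0#
  ∑-zero []       _   = refl
  ∑-zero (x ∷ xs) f≈0 = trans (+-cong (f≈0 x) (∑-zero xs f≈0)) (+-identityˡ 0#)

  ∑-+ : (xs : List A) (f g : A → Carrier) → ∑ xs (λ x → f x + g x) ≈ ∑ xs f + ∑ xs g
  ∑-+ []       f g = sym (+-identityˡ 0#)
  ∑-+ (x ∷ xs) f g = trans (+-congˡ (∑-+ xs f g))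
    (solve 4 (λ a b c d → a :+ b :+ (c :+ d) := a :+ c :+ (b :+ d)) refl (f x) (g x) (∑ xs f) (∑ xs g))

  ∑-minus : (xs : List A) (f g : A → Carrier) → ∑ xs (λ x → f x - g x) ≈ ∑ xs f - ∑ xs g
  ∑-minus []       f g = sym (-‿inverseʳ 0#)
  ∑-minus (x ∷ xs) f g = trans (+-congˡ (∑-minus xs f g))
    (solve 4 (λ a b c d → a :- b :+ (c :- d) := a :+ c :- (b :+ d)) refl (f x) (g x) (∑ xs f) (∑ xs g))

  *-distribˡ-∑ : (xs : List A) (c : Carrier) (f : A → Carrier) → c * ∑ xs f ≈ ∑ xs (λ x → c * f x)
  *-distribˡ-∑ []       c f = zeroʳ c
  *-distribˡ-∑ (x ∷ xs) c f = trans (distribˡ c (f x) (∑ xs f)) (+-congˡ (*-distribˡ-∑ xs c f))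

  *-distribʳ-∑ : (xs : List A) (c : Carrier) (f : A → Carrier) → ∑ xs f * c ≈ ∑ xs (λ x → f x * c)
  *-distribʳ-∑ []       c f = zeroˡ c
  *-distribʳ-∑ (x ∷ xs) c f = trans (distribʳ c (f x) (∑ xs f)) (+-congˡ (*-distribʳ-∑ xs c f))

  ∑-comm : (xs : List A) (ys : List B) (f : A → B → Carrier) →
           ∑ xs (λ x → ∑ ys (f x)) ≈ ∑ ys (λ y → ∑ xs (λ x → f x y))
  ∑-comm []       ys f = sym (∑-zero ys (λ _ → refl))
  ∑-comm (x ∷ xs) ys f = trans (+-congˡ (∑-comm xs ys f)) (sym (∑-+ ys (f x) _))

  ∑-++ : (xs ys : List A) (f : A → Carrier) → ∑ (xs ++ ys) f ≈ ∑ xs f + ∑ ys f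
  ∑-++ []       ys f = sym (+-identityˡ _)
  ∑-++ (x ∷ xs) ys f = trans (+-congˡ (∑-++ xs ys f)) (sym (+-assoc _ _ _))

  ∑-map : (h : A → B) (xs : List A) (f : B → Carrier) → ∑ (map h xs) f ≡ ∑ xs (λ x → f (h x))
  ∑-map h []       f = ≡.refl
  ∑-map h (x ∷ xs) f = ≡.cong (λ r → f (h x) + r) (∑-map h xs f)

  ∑-cartesianProduct : (xs : List A) (ys : List B) (f : A × B → Carrier) →
    ∑ (cartesianProduct xs ys) f ≈ ∑ xs (λ x → ∑ ys (λ y → f (x , y)))
  ∑-cartesianProduct []       ys f = refl
  ∑-cartesianProduct (x ∷ xs) ys f = trans (∑-++ (map (x ,_) ys) _ f)
    (+-cong (reflexive (∑-map (x ,_) ys f)) (∑-cartesianProduct xs ys f))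

  ∑-filter : {P : A → Set} (P? : Decidable P) (xs : List A) (f : A → Carrier) →
             ∑ (filter P? xs) f ≈ ∑ xs (λ x → 𝟙 (P? x) * f x)
  ∑-filter P? []       f = refl
  ∑-filter P? (x ∷ xs) f with P? x
  ... | yes _ = +-cong (sym (*-identityˡ _)) (∑-filter P? xs f)
  ... | no  _ = trans (∑-filter P? xs f) (trans (sym (+-identityˡ _)) (+-congʳ (sym (zeroˡ _))))

  ∑-𝟙-none : {P : A → Set} (P? : Decidable P) (xs : List A) (f : A → Carrier) →
             All (λ x → ¬ P x) xs → ∑ xs (λ x → 𝟙 (P? x) * f x) ≈ 0#
  ∑-𝟙-none P? []       f []          = refl
  ∑-𝟙-none P? (x ∷ xs) f (¬px ∷ ¬ps) = begin
    𝟙 (P? x) * f x + ∑ xs (λ x → 𝟙 (P? x) * f x) ≈⟨ +-cong (*-congʳ (𝟙-no (P? x) ¬px)) (∑-𝟙-none P? xs f ¬ps) ⟩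
    0# * f x + 0#                                ≈⟨ solve 1 (λ x → con (+ 0) :* x :+ con (+ 0) := con (+ 0)) refl (f x) ⟩
    0#                                           ∎
    where open ≈-Reasoning

  ∑-𝟙-unique : {P : A → Set} (P? : Decidable P) {xs : List A} (f : A → Carrier) {y : A} →
               Unique xs → y ∈ xs → P y → (∀ {x} → P x → x ≡ y) → ∑ xs (λ x → 𝟙 (P? x) * f x) ≈ f y
  ∑-𝟙-unique P? {x ∷ xs} f (x∉ ∷ _) (here ≡.refl) py only = begin
    𝟙 (P? x) * f x + ∑ xs (λ x → 𝟙 (P? x) * f x)
      ≈⟨ +-cong (*-congʳ (𝟙-yes (P? x) py)) (∑-𝟙-none P? xs f (All.map (λ x≢z pz → x≢z (≡.sym (only pz))) x∉)) ⟩
    1# * f x + 0#  ≈⟨ solve 1 (λ x → con (+ 1) :* x :+ con (+ 0) := x) refl (f x) ⟩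
    f x            ∎
    where open ≈-Reasoning
  ∑-𝟙-unique P? {x ∷ xs} f {y} (x∉ ∷ uniq) (there y∈) py only = begin
    𝟙 (P? x) * f x + ∑ xs (λ x → 𝟙 (P? x) * f x)
      ≈⟨ +-cong (*-congʳ (𝟙-no (P? x) (λ px → All.lookup x∉ y∈ (only px)))) (∑-𝟙-unique P? f uniq y∈ py only) ⟩
    0# * f x + f y  ≈⟨ solve 2 (λ x y → con (+ 0) :* x :+ y := y) refl (f x) (f y) ⟩
    f y             ∎
    where open ≈-Reasoning

  ∑-nonneg : (xs : List A) {f : A → Carrier} → (∀ x → 0# ≤ f x) → 0# ≤ ∑ xs f
  ∑-nonneg []       _   = ≤-refl
  ∑-nonneg (x ∷ xs) 0≤f = +-nonneg (0≤f x) (∑-nonneg xs 0≤f)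

  ∑-∈-≤ : {xs : List A} {f : A → Carrier} → (∀ x → 0# ≤ f x) → ∀ {y} → y ∈ xs → f y ≤ ∑ xs f
  ∑-∈-≤ {xs = x ∷ xs} {f} 0≤f (here ≡.refl) =
    ≤-respˡ-≈ (+-identityʳ (f x)) (+-mono-≤ ≤-refl (∑-nonneg xs 0≤f))
  ∑-∈-≤ {xs = x ∷ xs} {f} 0≤f (there y∈) =
    ≤-respˡ-≈ (+-identityˡ _) (+-mono-≤ (0≤f x) (∑-∈-≤ 0≤f y∈))

  0<∑⇒∃ : (xs : List A) {f : A → Carrier} → 0# < ∑ xs f → ∃[ x ] (x ∈ xs × 0# < f x)
  0<∑⇒∃ []       0<0 = contradiction 0<0 (<-irrefl refl)
  0<∑⇒∃ (x ∷ xs) {f} 0<∑ with 0# <? f x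
  ... | yes 0<fx = x , here ≡.refl , 0<fx
  ... | no  0≮fx =
    let (y , y∈ , 0<fy) = 0<∑⇒∃ xs (<-≤-trans 0<∑
          (≤-respʳ-≈ (+-identityˡ _) (+-monoˡ-≤ _ (≮⇒≥ 0≮fx))))
    in y , there y∈ , 0<fy

  argmin : (f : A → Carrier) {xs : List A} {x₀ : A} → x₀ ∈ xs →
           ∃[ x ] (x ∈ xs × (∀ {y} → y ∈ xs → f x ≤ f y))
  argmin f {x ∷ []}      _ = x , here ≡.refl , λ { (here ≡.refl) → ≤-refl }
  argmin f {x ∷ xs@(_ ∷ _)} _ with argmin f {xs} (here ≡.refl)
  ... | z , z∈ , min with ≤-total (f x) (f z)
  ... | inj₁ fx≤fz = x , here ≡.refl , λ { (here ≡.refl) → ≤-refl ; (there y∈) → ≤-trans fx≤fz (min y∈) }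
  ... | inj₂ fz≤fx = z , there z∈ , λ { (here ≡.refl) → fz≤fx ; (there y∈) → min y∈ }

  ∑-squares≤0 : {A : Set} {xs : List A} {f : A → Carrier} →
                ∑ xs (λ x → f x * f x) ≤ 0# → ∀ {x} → x ∈ xs → f x ≈ 0#
  ∑-squares≤0 {f = f} ∑≤0 {x} x∈ with f x ≟ 0#
  ... | yes eq = eq
  ... | no neq = contradiction (<-≤-trans (x≉0⇒0<x² neq) (∑-∈-≤ (λ x → square-nonneg (f x)) x∈)) (≤⇒≯ ∑≤0)

  -- Supplies the step size of the perturbed flow. The witness is the minimum of `1#` and of the
  -- ratios `f x / g x` over those `x` with `g x` positive; the other `x` impose no constraint.
  scale-below : {A : Set} (xs : List A) (f g : A → Carrier) → (∀ x → 0# < f x) →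
    ∃[ ε ] (0# < ε × (∀ {δ} → 0# < δ → δ ≤ ε → ∀ {x} → x ∈ xs → δ * g x ≤ f x))
  scale-below []       f g 0<f = 1# , 0<1 , λ _ _ ()
  scale-below (x ∷ xs) f g 0<f with scale-below xs f g 0<f
  ... | ε , 0<ε , below with 0# <? g x
  ... | no g≯0 = ε , 0<ε , λ { 0<δ δ≤ε (here ≡.refl) → ≤-trans
                                  (≤-respʳ-≈ (zeroʳ _) (*-monoˡ-≤ (<⇒≤ 0<δ) (≮⇒≥ g≯0))) (<⇒≤ (0<f x))
                             ; 0<δ δ≤ε (there x∈) → below 0<δ δ≤ε x∈ }
  ... | yes 0<g with ≤-total ε (f x / g x)
  ... | inj₁ ε≤ = ε , 0<ε , λ { 0<δ δ≤ε (here ≡.refl) → bound (≤-trans δ≤ε ε≤)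
                              ; 0<δ δ≤ε (there x∈) → below 0<δ δ≤ε x∈ }
    where
    bound : ∀ {δ} → δ ≤ f x / g x → δ * g x ≤ f x
    bound δ≤ = ≤-respʳ-≈ (x*[y/x]≈y 0<g (f x)) (≤-respˡ-≈ (*-comm _ _) (*-monoˡ-≤ (<⇒≤ 0<g) δ≤))
  ... | inj₂ ≤ε = f x / g x , *-pos (0<f x) (0<x⇒0<x⁻¹ 0<g) ,
                  λ { 0<δ δ≤ (here ≡.refl) → bound δ≤
                    ; 0<δ δ≤ (there x∈) → below 0<δ (≤-trans δ≤ ≤ε) x∈ }
    where
    bound : ∀ {δ} → δ ≤ f x / g x → δ * g x ≤ f x
    bound δ≤ = ≤-respʳ-≈ (x*[y/x]≈y 0<g (f x)) (≤-respˡ-≈ (*-comm _ _) (*-monoˡ-≤ (<⇒≤ 0<g) δ≤))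

-- Path flows and user equilibria in an arbitrary network.

module Networks (ℝ : Reals) where
  open Reals ℝ hiding (zero)
  open Flow ℝ
  open IntegerRingSolver ℝ
  open OrderedField ℝ
  open Sums ℝ

  module Walks (N : Network) (q : Carrier) where
    open Network N
    open Equilibrium N q

    walk-++ : ∀ {x y z} es {es′} → IsWalk x es y → IsWalk y es′ z → IsWalk x (es ++ es′) z
    walk-++ []       ≡.refl    w′ = w′
    walk-++ (e ∷ es) (t≡x , w) w′ = t≡x , walk-++ es w w′

    telescope : ∀ (π : Vertex → Carrier) {x y} es → IsWalk x es y →
                (∑[ e ← es ] (π (tail e) - π (head e))) ≈ π x - π y
    telescope π []       ≡.refl = sym (-‿inverseʳ _)
    telescope π {y = y} (e ∷ es) (≡.refl , w) = trans (+-congˡ (telescope π es w))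
      (solve 3 (λ a b c → a :- b :+ (b :- c) := a :- c) refl (π (tail e)) (π (head e)) (π y))

    -- A repeated edge would repeat its head, which `simple` excludes.
    route-unique : (P : Path) → Unique (route P)
    route-unique P = AllPairs.map (λ h≢h′ e≡e′ → h≢h′ (≡.cong head e≡e′))
                                  (AllPairs.map⁻ (AllPairs.tail (Path.simple P)))

  module PathFlows (N : Network) (edges-unique : Unique (Network.edges N))
                   (edges-complete : ∀ e → e ∈ Network.edges N)
                   (source≢target : Network.source N ≢ Network.target N) (q : Carrier) where
    open Network N
    open Equilibrium N q
    open Walks N q public
    open Membership _≟ₑ_ using (_∈?_)

    ∑-route : ∀ {es} → Unique es → (w : Edge → Carrier) →
              (∑[ e ← edges ] 𝟙 (e ∈? es) * w e) ≈ ∑ es w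
    ∑-route []              w = ∑-zero edges (λ e → zeroˡ (w e))
    ∑-route {e₀ ∷ es} (e₀∉ ∷ uniq) w = begin
      (∑[ e ← edges ] 𝟙 (e ∈? (e₀ ∷ es)) * w e)
        ≈⟨ ∑-cong edges (λ e → trans (*-congʳ (split e)) (distribʳ (w e) _ _)) ⟩
      (∑[ e ← edges ] (𝟙 (e ≟ₑ e₀) * w e + 𝟙 (e ∈? es) * w e))
        ≈⟨ ∑-+ edges _ _ ⟩
      (∑[ e ← edges ] 𝟙 (e ≟ₑ e₀) * w e) + (∑[ e ← edges ] 𝟙 (e ∈? es) * w e)
        ≈⟨ +-cong (∑-𝟙-unique (_≟ₑ e₀) w edges-unique (edges-complete e₀) ≡.refl (λ e≡ → e≡)) (∑-route uniq w) ⟩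
      w e₀ + ∑ es w ∎
      where
      open ≈-Reasoning
      split : ∀ e → 𝟙 (e ∈? (e₀ ∷ es)) ≈ 𝟙 (e ≟ₑ e₀) + 𝟙 (e ∈? es)
      split e = 𝟙-⊎ (e ≟ₑ e₀) (e ∈? es) (e ∈? (e₀ ∷ es))
        (λ { ≡.refl e₀∈ → All.lookup e₀∉ e₀∈ ≡.refl })
        (λ { (here p) → inj₁ p ; (there p) → inj₂ p })
        [ here , there ]′

    -- Exchange of the sums over edges and over paths. With latencies for `w` it writes the cost
    -- path by path; with potential differences for `w` the inner sums telescope.
    pairing : ∀ (D : PathFlow) {f : Edge → Carrier} → (∀ e → edgeFlow D e ≈ f e) → (w : Edge → Carrier) →
              (∑[ e ← edges ] f e * w e) ≈ (∑[ Ph ← D ] proj₂ Ph * ∑ (route (proj₁ Ph)) w)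
    pairing D {f} D≈f w = begin
      (∑[ e ← edges ] f e * w e)
        ≈⟨ ∑-cong edges (λ e → *-congʳ (D≈f e)) ⟨
      (∑[ e ← edges ] edgeFlow D e * w e)
        ≈⟨ ∑-cong edges (λ e → *-distribʳ-∑ D (w e) _) ⟩
      (∑[ e ← edges ] ∑[ Ph ← D ] (if does (e ∈? route (proj₁ Ph)) then proj₂ Ph else 0#) * w e)
        ≈⟨ ∑-comm edges D _ ⟩
      (∑[ Ph ← D ] ∑[ e ← edges ] (if does (e ∈? route (proj₁ Ph)) then proj₂ Ph else 0#) * w e)
        ≈⟨ ∑-cong D (λ Ph → trans (∑-cong edges (λ e → rearrange (e ∈? route (proj₁ Ph)) (proj₂ Ph) (w e)))
                                  (trans (sym (*-distribˡ-∑ edges (proj₂ Ph) _))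
                                         (*-congˡ (∑-route (route-unique (proj₁ Ph)) w)))) ⟩
      (∑[ Ph ← D ] proj₂ Ph * ∑ (route (proj₁ Ph)) w) ∎
      where
      open ≈-Reasoning
      rearrange : ∀ {P : Set} (d : Dec P) h x → (if does d then h else 0#) * x ≈ h * (𝟙 d * x)
      rearrange d h x = trans (*-congʳ (if≈𝟙* d h))
        (solve 3 (λ i h x → i :* h :* x := h :* (i :* x)) refl (𝟙 d) h x)

    -- Linear in `f`, and equal to the pairing of `f` with the drops of the potential
    -- `λ y → 𝟙 (y ≟ᵥ x)`, so `telescope-flow` applies to it.
    netOutflow : (Edge → Carrier) → Vertex → Carrier
    netOutflow f x = ∑[ e ← edges ] f e * (𝟙 (tail e ≟ᵥ x) - 𝟙 (head e ≟ᵥ x))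

    outflow-inflow : ∀ (f : Edge → Carrier) (x : Vertex) → outflow f x - inflow f x ≈ netOutflow f x
    outflow-inflow f x = begin
      outflow f x - inflow f x
        ≈⟨ +-cong (∑-filter (λ e → tail e ≟ᵥ x) edges f) (-‿cong (∑-filter (λ e → head e ≟ᵥ x) edges f)) ⟩
      (∑[ e ← edges ] 𝟙 (tail e ≟ᵥ x) * f e) - (∑[ e ← edges ] 𝟙 (head e ≟ᵥ x) * f e)
        ≈⟨ ∑-minus edges _ _ ⟨
      (∑[ e ← edges ] (𝟙 (tail e ≟ᵥ x) * f e - 𝟙 (head e ≟ᵥ x) * f e))
        ≈⟨ ∑-cong edges (λ e → solve 3 (λ i j x → i :* x :- j :* x := x :* (i :- j)) refl _ _ (f e)) ⟩
      netOutflow f x ∎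
      where open ≈-Reasoning

    isFeasible : ∀ {f : Edge → Carrier} → (∀ e → 0# ≤ f e) →
                 (∀ x → netOutflow f x ≈ q * (𝟙 (source ≟ᵥ x) - 𝟙 (target ≟ᵥ x))) → IsFeasible f
    isFeasible {f} 0≤f net = record
      { nonnegative  = 0≤f
      ; conservation = λ x x≢s x≢t → begin
          inflow f x                                  ≈⟨ solve 2 (λ o i → i := o :- (o :- i)) refl (outflow f x) (inflow f x) ⟩
          outflow f x - (outflow f x - inflow f x)    ≈⟨ +-congˡ (-‿cong (trans (outflow-inflow f x) (net x))) ⟩
          outflow f x - q * (𝟙 (source ≟ᵥ x) - 𝟙 (target ≟ᵥ x))
            ≈⟨ +-congˡ (-‿cong (*-congˡ (+-cong (𝟙-no (source ≟ᵥ x) (λ s≡x → x≢s (≡.sym s≡x)))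
                                        (-‿cong (𝟙-no (target ≟ᵥ x) (λ t≡x → x≢t (≡.sym t≡x))))))) ⟩
          outflow f x - q * (0# - 0#)                 ≈⟨ solve 2 (λ o q → o :- q :* (con (+ 0) :- con (+ 0)) := o) refl (outflow f x) q ⟩
          outflow f x                                 ∎
      ; sourceSupply = begin
          outflow f source - inflow f source          ≈⟨ trans (outflow-inflow f source) (net source) ⟩
          q * (𝟙 (source ≟ᵥ source) - 𝟙 (target ≟ᵥ source))
            ≈⟨ *-congˡ (+-cong (𝟙-yes (source ≟ᵥ source) ≡.refl) (-‿cong (𝟙-no (target ≟ᵥ source) (λ t≡s → source≢target (≡.sym t≡s))))) ⟩
          q * (1# - 0#)                               ≈⟨ solve 1 (λ q → q :* (con (+ 1) :- con (+ 0)) := q) refl q ⟩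
          q                                           ∎
      ; targetDemand = begin
          inflow f target - outflow f target          ≈⟨ solve 2 (λ o i → i :- o := :- (o :- i)) refl (outflow f target) (inflow f target) ⟩
          - (outflow f target - inflow f target)      ≈⟨ -‿cong (trans (outflow-inflow f target) (net target)) ⟩
          - (q * (𝟙 (source ≟ᵥ target) - 𝟙 (target ≟ᵥ target)))
            ≈⟨ -‿cong (*-congˡ (+-cong (𝟙-no (source ≟ᵥ target) source≢target) (-‿cong (𝟙-yes (target ≟ᵥ target) ≡.refl)))) ⟩
          - (q * (0# - 1#))                           ≈⟨ solve 1 (λ q → :- (q :* (con (+ 0) :- con (+ 1))) := q) refl q ⟩
          q                                           ∎
      }
      where open ≈-Reasoning

    amount : PathFlow → Carrier
    amount D = ∑ D proj₂

    telescope-flow : ∀ (D : PathFlow) {f : Edge → Carrier} → (∀ e → edgeFlow D e ≈ f e) → (π : Vertex → Carrier) →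
                     (∑[ e ← edges ] f e * (π (tail e) - π (head e))) ≈ amount D * (π source - π target)
    telescope-flow D D≈f π = begin
      _ ≈⟨ pairing D D≈f (λ e → π (tail e) - π (head e)) ⟩
      (∑[ Ph ← D ] proj₂ Ph * (∑[ e ← route (proj₁ Ph) ] (π (tail e) - π (head e))))
        ≈⟨ ∑-cong D (λ (P , h) → *-congˡ (telescope π (route P) (Path.isWalk P))) ⟩
      (∑[ Ph ← D ] proj₂ Ph * (π source - π target))
        ≈⟨ *-distribʳ-∑ D _ proj₂ ⟨
      amount D * (π source - π target) ∎
      where open ≈-Reasoning

    -- The potential `𝟙 (x ≟ᵥ target)` measures the net flow into the target in two ways:
    -- telescoping along the paths gives the total amount, feasibility gives `q`.
    amount≈q : ∀ {D : PathFlow} {f : Edge → Carrier} → IsFeasible f → IsDecomposition D f → amount D ≈ q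
    amount≈q {D} {f} feas dec = begin
      amount D
        ≈⟨ solve 1 (λ q → q := :- (q :* (con (+ 0) :- con (+ 1)))) refl (amount D) ⟩
      - (amount D * (0# - 1#))
        ≈⟨ -‿cong (*-congˡ (+-cong (𝟙-no (source ≟ᵥ target) source≢target) (-‿cong (𝟙-yes (target ≟ᵥ target) ≡.refl)))) ⟨
      - (amount D * (𝟙 (source ≟ᵥ target) - 𝟙 (target ≟ᵥ target)))
        ≈⟨ -‿cong (telescope-flow D (IsDecomposition.sumsTo dec) (λ x → 𝟙 (x ≟ᵥ target))) ⟨
      - netOutflow f target
        ≈⟨ -‿cong (outflow-inflow f target) ⟨
      - (outflow f target - inflow f target)
        ≈⟨ solve 2 (λ o i → :- (o :- i) := i :- o) refl (outflow f target) (inflow f target) ⟩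
      inflow f target - outflow f target
        ≈⟨ IsFeasible.targetDemand feas ⟩
      q ∎
      where open ≈-Reasoning

    -- Obtained by telescoping along the paths of `D`, and therefore valid also when the chord
    -- closes a directed cycle.
    flow-potential : ∀ {D : PathFlow} {f : Edge → Carrier} → IsFeasible f → IsDecomposition D f → (π : Vertex → Carrier) →
                     (∑[ e ← edges ] f e * (π (tail e) - π (head e))) ≈ q * (π source - π target)
    flow-potential {D} feas dec π =
      trans (telescope-flow D (IsDecomposition.sumsTo dec) π) (*-congʳ (amount≈q feas dec))

    amount-≤ : ∀ {D : PathFlow} {w : Path → Carrier} {c : Carrier} → All (λ Ph → 0# ≤ proj₂ Ph) D → (∀ P → c ≤ w P) →
               amount D * c ≤ (∑[ Ph ← D ] proj₂ Ph * w (proj₁ Ph))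
    amount-≤ {[]}          {c = c} []          _   = ≤-reflexive (zeroˡ c)
    amount-≤ {(P , h) ∷ D} {c = c} (0≤h ∷ 0≤D) c≤w =
      ≤-respˡ-≈ (sym (distribʳ c h (amount D))) (+-mono-≤ (*-monoˡ-≤ 0≤h (c≤w P)) (amount-≤ 0≤D c≤w))

    -- The amounts sum to `q > 0`, so some path `P₀` carries flow; its latency is `c`. Each path
    -- that carries flow is no slower than `P₀`, which bounds the cost, and no path at all is faster
    -- than `P₀`.
    latency-level : ∀ {f : Edge → Carrier} → 0# < q → IsUserEquilibrium f →
      ∃[ c ] (cost f ≤ q * c × (∀ P → c ≤ pathLatency f P))
    latency-level {f} 0<q (feas , D , dec , minimal) =
      pathLatency f P₀ , cost≤ , P₀-minimal
      where
      used : ∃[ Ph ] (Ph ∈ D × 0# < proj₂ Ph)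
      used = 0<∑⇒∃ D (<-respʳ-≈ (sym (amount≈q feas dec)) 0<q)

      P₀ = proj₁ (proj₁ used)

      P₀-minimal : ∀ P → pathLatency f P₀ ≤ pathLatency f P
      P₀-minimal = All.lookup minimal (proj₁ (proj₂ used)) (proj₂ (proj₂ used))

      bound : ∀ {D′ : PathFlow} → All (λ Ph → 0# ≤ proj₂ Ph) D′ →
              All (λ Ph → 0# < proj₂ Ph → ∀ P → pathLatency f (proj₁ Ph) ≤ pathLatency f P) D′ →
              (∑[ Ph ← D′ ] proj₂ Ph * pathLatency f (proj₁ Ph)) ≤ amount D′ * pathLatency f P₀
      bound []            []            = ≤-reflexive (sym (zeroˡ _))
      bound {(P , h) ∷ D′} (0≤h ∷ 0≤D′) (min ∷ mins) =
        ≤-respʳ-≈ (sym (distribʳ _ h (amount D′))) (+-mono-≤ (first 0≤h) (bound 0≤D′ mins))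
        where
        first : 0# ≤ h → h * pathLatency f P ≤ h * pathLatency f P₀
        first (inj₁ 0<h) = *-monoˡ-≤ (inj₁ 0<h) (min 0<h P₀)
        -- A listed path carrying nothing may be slower than `P₀`, but it contributes zero to both
        -- sides.
        first (inj₂ 0≈h) = ≤-reflexive (begin
          h * _    ≈⟨ *-congʳ 0≈h ⟨
          0# * _   ≈⟨ zeroˡ _ ⟩
          0#       ≈⟨ zeroˡ _ ⟨
          0# * _   ≈⟨ *-congʳ 0≈h ⟩
          h * _    ∎)
          where open ≈-Reasoning

      cost≤ : cost f ≤ q * pathLatency f P₀
      cost≤ = begin
        cost f
          ≈⟨ pairing D (IsDecomposition.sumsTo dec) (λ e → latency e (f e)) ⟩
        (∑[ Ph ← D ] proj₂ Ph * pathLatency f (proj₁ Ph))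
          ≤⟨ bound (IsDecomposition.nonnegative dec) minimal ⟩
        amount D * pathLatency f P₀
          ≈⟨ *-congʳ (amount≈q feas dec) ⟩
        q * pathLatency f P₀ ∎
        where open ≤-Reasoning

    -- The variational inequality of equilibrium: with latencies frozen at `f`, the flow `g` sends
    -- the same amount `q` along paths each of latency at least `c`.
    equilibrium-optimal : ∀ {f g : Edge → Carrier} {D : PathFlow} → 0# < q → IsUserEquilibrium f → IsFeasible g → IsDecomposition D g →
                          cost f ≤ (∑[ e ← edges ] g e * latency e (f e))
    equilibrium-optimal {f} {g} {D} 0<q ue feas dec =
      let (c , cost≤ , c≤) = latency-level 0<q ue in begin
      cost f       ≤⟨ cost≤ ⟩
      q * c        ≈⟨ *-congʳ (amount≈q feas dec) ⟨
      amount D * c ≤⟨ amount-≤ {D} {pathLatency f} (IsDecomposition.nonnegative dec) c≤ ⟩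
      (∑[ Ph ← D ] proj₂ Ph * pathLatency f (proj₁ Ph))
        ≈⟨ pairing D (IsDecomposition.sumsTo dec) (λ e → latency e (f e)) ⟨
      (∑[ e ← edges ] g e * latency e (f e)) ∎
      where open ≤-Reasoning

    -- Telescoping gives every path the same latency, so the equilibrium condition holds with
    -- equality and the cost is `q` times that common latency.
    potential-equilibrium : ∀ {f : Edge → Carrier} {D : PathFlow} (π : Vertex → Carrier) →
      IsFeasible f → IsDecomposition D f → (∀ e → latency e (f e) ≈ π (tail e) - π (head e)) →
      IsUserEquilibrium f × cost f ≈ q * (π source - π target)
    potential-equilibrium {f} {D} π feas dec lat =
      (feas , D , dec , All.universal (λ (P , _) _ P′ → ≤-reflexive (trans (level P) (sym (level P′)))) D) ,
      trans (∑-cong edges (λ e → *-congˡ (lat e))) (flow-potential feas dec π)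
      where
      level : ∀ P → pathLatency f P ≈ π source - π target
      level P = trans (∑-cong (route P) lat) (telescope π (route P) (Path.isWalk P))

    -- Decomposition of flows in networks with a strictly increasing rank.

    module Acyclic (rank : Vertex → ℕ) (rank-< : ∀ e → rank (tail e) ℕ.< rank (head e))
                   (source-min : ∀ x → rank source ℕ.≤ rank x) (target-max : ∀ x → rank x ℕ.≤ rank target) where

      walk-ranks : ∀ {x y} es → IsWalk x es y → All (λ z → rank x ℕ.< rank z) (map head es)
      walk-ranks []       _            = []
      walk-ranks (e ∷ es) (≡.refl , w) = rank-< e ∷ All.map (ℕ.<-trans (rank-< e)) (walk-ranks es w)

      -- Ranks rise strictly along a walk, so no vertex recurs.
      walk-simple : ∀ {x y} es → IsWalk x es y → Unique (x ∷ map head es)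
      walk-simple []       _ = [] ∷ []
      walk-simple (e ∷ es) w@(_ , w′) =
        All.map (λ { lt ≡.refl → ℕ.<-irrefl ≡.refl lt }) (walk-ranks (e ∷ es) w) ∷ walk-simple es w′

      -- Conservation without a prescribed value: removing a path lowers the amount shipped but
      -- preserves this property.
      Balanced : (Edge → Carrier) → Set
      Balanced f = ∀ x → x ≢ source → x ≢ target → netOutflow f x ≈ 0#

      module _ {f : Edge → Carrier} (0≤f : ∀ e → 0# ≤ f e) (balanced : Balanced f) where

        private
          f𝟙-nonneg : ∀ {P : Edge → Set} (d : ∀ e → Dec (P e)) e → 0# ≤ f e * 𝟙 (d e)
          f𝟙-nonneg d e = *-nonneg (0≤f e) (𝟙-nonneg (d e))

          positive-part : ∀ {P : Set} (d : Dec P) {x} → 0# < x * 𝟙 d → P × 0# < x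
          positive-part (yes p) {x} lt = p , <-respʳ-≈ (*-identityʳ x) lt
          positive-part (no _)  {x} lt = contradiction (<-respʳ-≈ (zeroʳ x) lt) (<-irrefl refl)

          out≈in : ∀ x → x ≢ source → x ≢ target →
                   (∑[ e ← edges ] f e * 𝟙 (tail e ≟ᵥ x)) ≈ (∑[ e ← edges ] f e * 𝟙 (head e ≟ᵥ x))
          out≈in x x≢s x≢t = begin
            O            ≈⟨ solve 2 (λ o i → o := i :+ (o :- i)) refl O I ⟩
            I + (O - I)  ≈⟨ +-congˡ (∑-minus edges _ _) ⟨
            I + (∑[ e ← edges ] (f e * 𝟙 (tail e ≟ᵥ x) - f e * 𝟙 (head e ≟ᵥ x)))
              ≈⟨ +-congˡ (∑-cong edges (λ e → solve 3 (λ x i j → x :* i :- x :* j := x :* (i :- j)) refl (f e) _ _)) ⟩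
            I + netOutflow f x ≈⟨ +-congˡ (balanced x x≢s x≢t) ⟩
            I + 0#       ≈⟨ +-identityʳ I ⟩
            I            ∎
            where
            open ≈-Reasoning
            O = ∑[ e ← edges ] f e * 𝟙 (tail e ≟ᵥ x)
            I = ∑[ e ← edges ] f e * 𝟙 (head e ≟ᵥ x)

          -- The rank rises along `e`, so its tail is not the target and conservation holds there:
          -- positive outflow forces positive inflow. `outgoing` is the mirror image.
          incoming : ∀ {e} → 0# < f e → tail e ≢ source → ∃[ e′ ] (head e′ ≡ tail e × 0# < f e′)
          incoming {e} 0<fe t≢s =
            let t≢t = λ t≡ → ℕ.<⇒≱ (rank-< e) (≡.subst (λ x → rank (head e) ℕ.≤ rank x) (≡.sym t≡) (target-max (head e)))
                (e′ , _ , pos) = 0<∑⇒∃ edges (<-≤-trans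
                  (<-respʳ-≈ (sym (trans (*-congˡ (𝟙-yes (tail e ≟ᵥ tail e) ≡.refl)) (*-identityʳ _))) 0<fe)
                  (≤-respʳ-≈ (out≈in (tail e) t≢s t≢t)
                    (∑-∈-≤ (f𝟙-nonneg (λ e′ → tail e′ ≟ᵥ tail e)) (edges-complete e))))
            in e′ , positive-part (head e′ ≟ᵥ tail e) pos

          outgoing : ∀ {e} → 0# < f e → head e ≢ target → ∃[ e′ ] (tail e′ ≡ head e × 0# < f e′)
          outgoing {e} 0<fe h≢t =
            let h≢s = λ h≡ → ℕ.<⇒≱ (rank-< e) (≡.subst (λ x → rank x ℕ.≤ rank (tail e)) (≡.sym h≡) (source-min (tail e)))
                (e′ , _ , pos) = 0<∑⇒∃ edges (<-≤-trans
                  (<-respʳ-≈ (sym (trans (*-congˡ (𝟙-yes (head e ≟ᵥ head e) ≡.refl)) (*-identityʳ _))) 0<fe)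
                  (≤-respʳ-≈ (sym (out≈in (head e) h≢s h≢t))
                    (∑-∈-≤ (f𝟙-nonneg (λ e′ → head e′ ≟ᵥ head e)) (edges-complete e))))
            in e′ , positive-part (tail e′ ≟ᵥ head e) pos

          -- The bound `k` on the rank of the tail falls with every step back; at `zero` no edge can
          -- enter the tail.
          backward : ∀ k {e} → rank (tail e) ℕ.≤ k → 0# < f e →
                     ∃[ es ] (IsWalk source es (tail e) × All (λ e → 0# < f e) es)
          backward k {e} le 0<fe with tail e ≟ᵥ source
          ... | yes t≡s = [] , ≡.sym t≡s , []
          backward zero {e} le 0<fe | no t≢s =
            let (e′ , h≡t , _) = incoming 0<fe t≢s
            in contradiction (ℕ.≤-trans (≡.subst (λ x → rank (tail e′) ℕ.< rank x) h≡t (rank-< e′)) le) λ ()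
          backward (suc k) {e} le 0<fe | no t≢s =
            let (e′ , h≡t , 0<fe′) = incoming 0<fe t≢s
                rank-<′ = ≡.subst (λ x → rank (tail e′) ℕ.< rank x) h≡t (rank-< e′)
                (es , w , pos) = backward k {e′} (ℕ.s≤s⁻¹ (ℕ.≤-trans rank-<′ le)) 0<fe′
            in es ++ e′ ∷ [] , walk-++ es w (≡.refl , h≡t) , All.++⁺ pos (0<fe′ ∷ [])

          -- Here `k` bounds the rank still missing between the head and the target.
          forward : ∀ k {e} → rank target ℕ.≤ k ℕ.+ rank (head e) → 0# < f e →
                    ∃[ es ] (IsWalk (head e) es target × All (λ e → 0# < f e) es)
          forward k {e} le 0<fe with head e ≟ᵥ target
          ... | yes h≡t = [] , h≡t , []
          forward zero {e} le 0<fe | no h≢t =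
            let (e′ , t≡h , _) = outgoing 0<fe h≢t
                rank-<′ = ≡.subst (λ x → rank x ℕ.< rank (head e′)) t≡h (rank-< e′)
            in contradiction (ℕ.<-≤-trans rank-<′ (target-max _)) (ℕ.≤⇒≯ le)
          forward (suc k) {e} le 0<fe | no h≢t =
            let (e′ , t≡h , 0<fe′) = outgoing 0<fe h≢t
                rank-<′ = ≡.subst (λ x → rank x ℕ.< rank (head e′)) t≡h (rank-< e′)
                le′ = ℕ.≤-trans (ℕ.≤-trans le (ℕ.≤-reflexive (≡.sym (ℕ.+-suc k _)))) (ℕ.+-monoʳ-≤ k rank-<′)
                (es , w , pos) = forward k {e′} le′ 0<fe′
            in e′ ∷ es , (t≡h , w) , 0<fe′ ∷ pos

        positive-path : ∀ {e} → 0# < f e → ∃[ P ] (e ∈ route P × All (λ e → 0# < f e) (route P))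
        positive-path {e} 0<fe =
          let (es , w , pos)    = backward (rank (tail e)) ℕ.≤-refl 0<fe
              (es′ , w′ , pos′) = forward (rank target) {e} (ℕ.m≤m+n _ _) 0<fe
              walk              = walk-++ es w (≡.refl , w′)
          in record { route = es ++ e ∷ es′ ; isWalk = walk ; simple = walk-simple (es ++ e ∷ es′) walk }
           , ∈-++⁺ʳ es (here ≡.refl) , All.++⁺ pos (0<fe ∷ pos′)

      -- The exact length serves as the termination measure of the decomposition. Other copies of
      -- `e` may survive in `es′`, which does no harm to a list that only has to cover a support.
      remove : ∀ {e : Edge} {es} → e ∈ es →
               ∃[ es′ ] (length es ≡ suc (length es′) × (∀ {e′} → e′ ∈ es → e′ ≡ e ⊎ e′ ∈ es′))
      remove {es = _ ∷ es} (here ≡.refl) = es , ≡.refl , λ { (here p) → inj₁ p ; (there p) → inj₂ p }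
      remove {es = e₀ ∷ es} (there e∈) with remove e∈
      ... | es′ , len , sub = e₀ ∷ es′ , ≡.cong suc len ,
        λ { (here p) → inj₂ (here p) ; (there p) → [ inj₁ , (λ q → inj₂ (there q)) ]′ (sub p) }

      path-balanced : ∀ P x → x ≢ source → x ≢ target → netOutflow (λ e → 𝟙 (e ∈? route P)) x ≈ 0#
      path-balanced P x x≢s x≢t = begin
        netOutflow (λ e → 𝟙 (e ∈? route P)) x
          ≈⟨ ∑-route (route-unique P) _ ⟩
        (∑[ e ← route P ] (𝟙 (tail e ≟ᵥ x) - 𝟙 (head e ≟ᵥ x)))
          ≈⟨ telescope (λ y → 𝟙 (y ≟ᵥ x)) (route P) (Path.isWalk P) ⟩
        𝟙 (source ≟ᵥ x) - 𝟙 (target ≟ᵥ x)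
          ≈⟨ +-cong (𝟙-no (source ≟ᵥ x) (λ p → x≢s (≡.sym p))) (-‿cong (𝟙-no (target ≟ᵥ x) (λ p → x≢t (≡.sym p)))) ⟩
        0# - 0#
          ≈⟨ -‿inverseʳ 0# ⟩
        0# ∎
        where open ≈-Reasoning

      -- Every step removes a path through a positive edge at the bottleneck value, so one more
      -- edge of the list `es` covering the support of the flow can be dropped.
      decompose-supported : ∀ k (es : List Edge) → length es ℕ.≤ k → ∀ (f : Edge → Carrier) → (∀ e → 0# ≤ f e) → Balanced f →
                            (∀ {e} → 0# < f e → e ∈ es) → ∃[ D ] IsDecomposition D f
      decompose-supported k [] _ f 0≤f bal supp = [] , record
        { nonnegative = []
        ; sumsTo = λ e → antisym (0≤f e) (≮⇒≥ (λ 0<fe → contradiction (supp 0<fe) λ ()))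
        }
      decompose-supported (suc k) (e₀ ∷ es) len f 0≤f bal supp with 0# <? f e₀
      ... | no 0≮fe₀ = decompose-supported k es (ℕ.s≤s⁻¹ len) f 0≤f bal
              (λ {e} 0<fe → drop (supp 0<fe) 0<fe)
        where
        drop : ∀ {e} → e ∈ e₀ ∷ es → 0# < f e → e ∈ es
        drop (here ≡.refl) 0<fe = contradiction 0<fe 0≮fe₀
        drop (there e∈)    _    = e∈
      ... | yes 0<fe₀ with positive-path 0≤f bal 0<fe₀
      ... | P , e₀∈P , pos with argmin f e₀∈P
      ... | e₁ , e₁∈P , min with remove (supp (All.lookup pos e₁∈P))
      ... | es′ , len′ , sub = (P , f e₁) ∷ D , record
        { nonnegative = 0≤f e₁ ∷ IsDecomposition.nonnegative dec
        ; sumsTo = λ e → begin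
            (if does (e ∈? route P) then f e₁ else 0#) + edgeFlow D e
              ≈⟨ +-cong (if≈𝟙* (e ∈? route P) (f e₁)) (IsDecomposition.sumsTo dec e) ⟩
            𝟙 (e ∈? route P) * f e₁ + f′ e
              ≈⟨ solve 3 (λ i x y → i :* x :+ (y :- i :* x) := y) refl (𝟙 (e ∈? route P)) (f e₁) (f e) ⟩
            f e ∎
        }
        where
        open ≈-Reasoning

        f′ : Edge → Carrier
        f′ e = f e - 𝟙 (e ∈? route P) * f e₁

        0≤f′ : ∀ e → 0# ≤ f′ e
        0≤f′ e with e ∈? route P
        ... | yes e∈ = x≤y⇒0≤y-x (≤-respˡ-≈ (sym (*-identityˡ _)) (min e∈))
        ... | no  _  = x≤y⇒0≤y-x (≤-respˡ-≈ (sym (zeroˡ _)) (0≤f e))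

        bal′ : Balanced f′
        bal′ x x≢s x≢t = begin
          netOutflow f′ x
            ≈⟨ ∑-cong edges (λ e → solve 5 (λ f i c a b → (f :- i :* c) :* (a :- b) := f :* (a :- b) :- c :* (i :* (a :- b)))
                                     refl (f e) (𝟙 (e ∈? route P)) (f e₁) (𝟙 (tail e ≟ᵥ x)) (𝟙 (head e ≟ᵥ x))) ⟩
          (∑[ e ← edges ] (f e * _ - f e₁ * (𝟙 (e ∈? route P) * (𝟙 (tail e ≟ᵥ x) - 𝟙 (head e ≟ᵥ x)))))
            ≈⟨ ∑-minus edges _ _ ⟩
          netOutflow f x - (∑[ e ← edges ] f e₁ * (𝟙 (e ∈? route P) * (𝟙 (tail e ≟ᵥ x) - 𝟙 (head e ≟ᵥ x))))
            ≈⟨ +-cong (bal x x≢s x≢t) (-‿cong (trans (sym (*-distribˡ-∑ edges (f e₁) _)) (*-congˡ (path-balanced P x x≢s x≢t)))) ⟩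
          0# - f e₁ * 0#
            ≈⟨ solve 1 (λ c → con (+ 0) :- c :* con (+ 0) := con (+ 0)) refl (f e₁) ⟩
          0# ∎

        f′e₁≈0 : f′ e₁ ≈ 0#
        f′e₁≈0 = trans (+-congˡ (-‿cong (trans (*-congʳ (𝟙-yes (e₁ ∈? route P) e₁∈P)) (*-identityˡ _)))) (-‿inverseʳ _)

        f′≤f : ∀ e → f′ e ≤ f e
        f′≤f e = 0≤y-x⇒x≤y (≤-respʳ-≈
          (solve 3 (λ i x y → i :* x := y :- (y :- i :* x)) refl (𝟙 (e ∈? route P)) (f e₁) (f e))
          (*-nonneg (𝟙-nonneg (e ∈? route P)) (0≤f e₁)))

        supp′ : ∀ {e} → 0# < f′ e → e ∈ es′
        supp′ {e} 0<f′e with sub (supp (<-≤-trans 0<f′e (f′≤f e)))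
        ... | inj₁ ≡.refl = contradiction (<-respʳ-≈ f′e₁≈0 0<f′e) (<-irrefl refl)
        ... | inj₂ e∈     = e∈

        rest = decompose-supported k es′ (ℕ.s≤s⁻¹ (≡.subst (ℕ._≤ suc k) len′ len)) f′ 0≤f′ bal′ supp′
        D   = proj₁ rest
        dec = proj₂ rest

      decompose : ∀ {f : Edge → Carrier} → IsFeasible f → ∃[ D ] IsDecomposition D f
      decompose {f} feas = decompose-supported (length edges) edges ℕ.≤-refl f
        (IsFeasible.nonnegative feas)
        (λ x x≢s x≢t → trans (sym (outflow-inflow f x))
          (trans (+-congˡ (-‿cong (IsFeasible.conservation feas x x≢s x≢t))) (-‿inverseʳ _)))
        (λ {e} _ → edges-complete e)

-- Vertices, edges and levels of the grid.

module GridGraph (m n : ℕ) where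
  open Grid m n

  vertices-unique : Unique vertices
  vertices-unique = Unique.cartesianProduct⁺ (Unique.allFin⁺ (suc m)) (Unique.allFin⁺ (suc n))

  vertices-complete : ∀ x → x ∈ vertices
  vertices-complete (i , j) = ∈-cartesianProduct⁺ (∈-allFin i) (∈-allFin j)

  gridEdges-unique : Unique gridEdges
  gridEdges-unique = Unique.++⁺
    (Unique.map⁺ Sum.inj₁-injective (Unique.cartesianProduct⁺ (Unique.allFin⁺ m) (Unique.allFin⁺ (suc n))))
    (Unique.map⁺ Sum.inj₂-injective (Unique.cartesianProduct⁺ (Unique.allFin⁺ (suc m)) (Unique.allFin⁺ n)))
    (λ (e∈₁ , e∈₂) → disjoint (∈-map⁻ inj₁ e∈₁) (∈-map⁻ inj₂ e∈₂))
    where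
    disjoint : ∀ {e : GridEdge} {xs ys} → ∃[ x ] (x ∈ xs × e ≡ inj₁ x) → ¬ (∃[ y ] (y ∈ ys × e ≡ inj₂ y))
    disjoint (_ , _ , ≡.refl) (_ , _ , ())

  gridEdges-complete : ∀ e → e ∈ gridEdges
  gridEdges-complete (inj₁ (i , j)) = ∈-++⁺ˡ (∈-map⁺ inj₁ (∈-cartesianProduct⁺ (∈-allFin i) (∈-allFin j)))
  gridEdges-complete (inj₂ (i , j)) = ∈-++⁺ʳ _ (∈-map⁺ inj₂ (∈-cartesianProduct⁺ (∈-allFin i) (∈-allFin j)))

  level-step : ∀ e → level (gridHead e) ≡ suc (level (gridTail e))
  level-step (inj₁ (i , j)) = ≡.cong (λ k → suc (k ℕ.+ toℕ j)) (≡.sym (Fin.toℕ-inject₁ i))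
  level-step (inj₂ (i , j)) = ≡.trans (ℕ.+-suc (toℕ i) (toℕ j))
    (≡.cong (λ k → suc (toℕ i ℕ.+ k)) (≡.sym (Fin.toℕ-inject₁ j)))

  level-< : ∀ e → level (gridTail e) ℕ.< level (gridHead e)
  level-< e = ℕ.≤-reflexive (≡.sym (level-step e))

  level-≤-t : ∀ x → level x ℕ.≤ level t
  level-≤-t (i , j) = ℕ.+-mono-≤
    (≡.subst (toℕ i ℕ.≤_) (≡.sym (Fin.toℕ-fromℕ m)) (Fin.toℕ≤pred[n] i))
    (≡.subst (toℕ j ℕ.≤_) (≡.sym (Fin.toℕ-fromℕ n)) (Fin.toℕ≤pred[n] j))

  tail≢head : ∀ e → gridTail e ≢ gridHead e
  tail≢head e t≡h = ℕ.<-irrefl (≡.cong level t≡h) (level-< e)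

  Joins : GridEdge → Vertex → Vertex → Set
  Joins e x y = (gridTail e ≡ x × gridHead e ≡ y) ⊎ (gridTail e ≡ y × gridHead e ≡ x)

  ¬joins-self : ∀ {e x} → ¬ Joins e x x
  ¬joins-self {e} (inj₁ (p , q)) = tail≢head e (≡.trans p (≡.sym q))
  ¬joins-self {e} (inj₂ (p , q)) = tail≢head e (≡.trans p (≡.sym q))

  ¬adjacent-self : ∀ {x} → ¬ Adjacent x x
  ¬adjacent-self adj = ¬joins-self (proj₂ (proj₂ (find adj)))

  adjacent-sym : ∀ {x y} → Adjacent x y → Adjacent y x
  adjacent-sym = Any.map [ inj₂ , inj₁ ]′

  edge-determined : ∀ e e′ → gridTail e ≡ gridTail e′ → gridHead e ≡ gridHead e′ → e ≡ e′
  edge-determined (inj₁ (i , j)) (inj₁ (i′ , j′)) _ h≡ =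
    ≡.cong₂ (λ i j → inj₁ (i , j)) (Fin.suc-injective (Product.,-injectiveˡ h≡)) (Product.,-injectiveʳ h≡)
  edge-determined (inj₂ (i , j)) (inj₂ (i′ , j′)) _ h≡ =
    ≡.cong₂ (λ i j → inj₂ (i , j)) (Product.,-injectiveˡ h≡) (Fin.suc-injective (Product.,-injectiveʳ h≡))
  edge-determined (inj₁ (i , j)) (inj₂ (i′ , j′)) t≡ h≡ = contradiction
    (≡.trans (≡.cong toℕ (Product.,-injectiveˡ t≡)) (≡.cong toℕ (≡.sym (Product.,-injectiveˡ h≡))))
    (λ eq → ℕ.1+n≢n (≡.trans (≡.sym eq) (Fin.toℕ-inject₁ i)))
  edge-determined (inj₂ (i , j)) (inj₁ (i′ , j′)) t≡ h≡ = contradiction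
    (≡.trans (≡.cong toℕ (≡.sym (Product.,-injectiveˡ t≡))) (≡.cong toℕ (Product.,-injectiveˡ h≡)))
    (λ eq → ℕ.1+n≢n (≡.trans (≡.sym eq) (Fin.toℕ-inject₁ i′)))

  -- Levels rise along edges, so two edges joining the same vertices point the same way, and the
  -- grid has no parallel edges. Adjacency can thus be counted by a sum over edges.
  joins-determined : ∀ {x y} e e′ → Joins e x y → Joins e′ x y → e ≡ e′
  joins-determined e e′ (inj₁ (p , q)) (inj₁ (p′ , q′)) = edge-determined e e′ (≡.trans p (≡.sym p′)) (≡.trans q (≡.sym q′))
  joins-determined e e′ (inj₂ (p , q)) (inj₂ (p′ , q′)) = edge-determined e e′ (≡.trans p (≡.sym p′)) (≡.trans q (≡.sym q′))
  joins-determined e e′ (inj₁ (p , q)) (inj₂ (p′ , q′)) = contradiction (level-< e′)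
    (ℕ.<⇒≯ (≡.subst₂ ℕ._<_ (≡.cong level (≡.trans p (≡.sym q′))) (≡.cong level (≡.trans q (≡.sym p′))) (level-< e)))
  joins-determined e e′ (inj₂ (p , q)) (inj₁ (p′ , q′)) = contradiction (level-< e′)
    (ℕ.<⇒≯ (≡.subst₂ ℕ._<_ (≡.cong level (≡.trans p (≡.sym q′))) (≡.cong level (≡.trans q (≡.sym p′))) (level-< e)))

-- The Laplacian as the divergence of a gradient.

module Laplacian (ℝ : Reals) (m n : ℕ) where
  open Reals ℝ hiding (zero)
  open Flow ℝ
  open Grid m n
  open GridGraph m n
  open IntegerRingSolver ℝ
  open OrderedField ℝ
  open Sums ℝ

  -- Unfolds to the `netOutflow` of `gridNetwork`, so results pass between the two by computation.
  divergence : (GridEdge → Carrier) → Vertex → Carrier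
  divergence f x = ∑[ e ← gridEdges ] f e * (𝟙 (gridTail e ≟ᵥ x) - 𝟙 (gridHead e ≟ᵥ x))

  drop : (Vertex → Carrier) → GridEdge → Carrier
  drop φ e = φ (gridTail e) - φ (gridHead e)

  𝟙-sift : ∀ z x (g : Vertex → Carrier) → 𝟙 (z ≟ᵥ x) * g x ≈ 𝟙 (z ≟ᵥ x) * g z
  𝟙-sift z x g with z ≟ᵥ x
  ... | yes ≡.refl = refl
  ... | no  _      = trans (zeroˡ _) (sym (zeroˡ _))

  ∑-sift : ∀ z (g : Vertex → Carrier) → (∑[ x ← vertices ] 𝟙 (z ≟ᵥ x) * g x) ≈ g z
  ∑-sift z g = ∑-𝟙-unique (z ≟ᵥ_) g vertices-unique (vertices-complete z) ≡.refl ≡.sym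

  -- At most one element satisfies `P`, so the indicator of existence equals the count.
  𝟙-any : {A : Set} {P : A → Set} (P? : Decidable P) {xs : List A} → Unique xs →
          (∀ {x y} → P x → P y → x ≡ y) → 𝟙 (any? P? xs) ≈ (∑[ x ← xs ] 𝟙 (P? x))
  𝟙-any P? {xs} uniq det with any? P? xs
  ... | yes p = let (y , y∈ , py) = find p in
    sym (trans (∑-cong xs (λ x → sym (*-identityʳ _))) (∑-𝟙-unique P? (λ _ → 1#) uniq y∈ py (λ px → det px py)))
  ... | no ¬p = sym (trans (∑-cong xs (λ x → sym (*-identityʳ _))) (∑-𝟙-none P? xs (λ _ → 1#) (All.¬Any⇒All¬ xs ¬p)))

  adjacency : ∀ x y → 𝟙 (adjacent? x y) ≈
    (∑[ e ← gridEdges ] (𝟙 (gridTail e ≟ᵥ x) * 𝟙 (gridHead e ≟ᵥ y) + 𝟙 (gridHead e ≟ᵥ x) * 𝟙 (gridTail e ≟ᵥ y)))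
  adjacency x y = trans (𝟙-any _ gridEdges-unique (λ {e} {e′} → joins-determined e e′)) (∑-cong gridEdges term)
    where
    term : ∀ e → 𝟙 (((gridTail e ≟ᵥ x) ×-dec (gridHead e ≟ᵥ y)) ⊎-dec ((gridTail e ≟ᵥ y) ×-dec (gridHead e ≟ᵥ x))) ≈
                 𝟙 (gridTail e ≟ᵥ x) * 𝟙 (gridHead e ≟ᵥ y) + 𝟙 (gridHead e ≟ᵥ x) * 𝟙 (gridTail e ≟ᵥ y)
    term e = trans (𝟙-⊎ d d′ (d ⊎-dec d′) (λ (p , _) (_ , q) → tail≢head e (≡.trans p (≡.sym q))) (λ r → r) (λ r → r))
      (+-cong (𝟙-∧ (gridTail e ≟ᵥ x) (gridHead e ≟ᵥ y) d (λ r → r) _,_)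
              (𝟙-∧ (gridHead e ≟ᵥ x) (gridTail e ≟ᵥ y) d′ (λ (p , q) → q , p) (λ p q → q , p)))
      where
      d  = (gridTail e ≟ᵥ x) ×-dec (gridHead e ≟ᵥ y)
      d′ = (gridTail e ≟ᵥ y) ×-dec (gridHead e ≟ᵥ x)

  fromNat-length : {A : Set} (xs : List A) → fromNat (length xs) ≈ (∑[ x ← xs ] 1#)
  fromNat-length []       = refl
  fromNat-length (_ ∷ xs) = +-congˡ (fromNat-length xs)

  degree-sum : ∀ x → fromNat (degree x) ≈ (∑[ y ← vertices ] 𝟙 (adjacent? x y))
  degree-sum x = trans (fromNat-length (filter (adjacent? x) vertices))
    (trans (∑-filter (adjacent? x) vertices _) (∑-cong vertices (λ y → *-identityʳ _)))

  laplacian-entry : ∀ a x y → laplacian m n a x y ≈ (𝟙 (x ≟ᵥ y) * fromNat (degree x) - 𝟙 (adjacent? x y)) * a ⁻¹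
  laplacian-entry a x y with x ≟ᵥ y
  ... | yes ≡.refl = *-congʳ (begin
      fromNat (degree x)                                ≈⟨ solve 1 (λ d → d := con (+ 1) :* d :- con (+ 0)) refl _ ⟩
      1# * fromNat (degree x) - 0#                      ≈⟨ +-congˡ (-‿cong (𝟙-no (adjacent? x x) ¬adjacent-self)) ⟨
      1# * fromNat (degree x) - 𝟙 (adjacent? x x)       ∎)
      where open ≈-Reasoning
  ... | no _ with adjacent? x y
  ...   | yes _ = solve 2 (λ d r → :- (con (+ 1) :* r) := (con (+ 0) :* d :- con (+ 1)) :* r) refl (fromNat (degree x)) (a ⁻¹)
  ...   | no  _ = solve 2 (λ d r → con (+ 0) := (con (+ 0) :* d :- con (+ 0)) :* r) refl (fromNat (degree x)) (a ⁻¹)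

  laplacian-sym : ∀ a x y → laplacian m n a x y ≈ laplacian m n a y x
  laplacian-sym a x y = begin
    laplacian m n a x y                                              ≈⟨ laplacian-entry a x y ⟩
    (𝟙 (x ≟ᵥ y) * fromNat (degree x) - 𝟙 (adjacent? x y)) * a ⁻¹
      ≈⟨ *-congʳ (+-cong (𝟙-sift x y (λ z → fromNat (degree z)))
                         (-‿cong (𝟙-cong (adjacent? y x) (adjacent? x y) adjacent-sym adjacent-sym))) ⟨
    (𝟙 (x ≟ᵥ y) * fromNat (degree y) - 𝟙 (adjacent? y x)) * a ⁻¹
      ≈⟨ *-congʳ (+-congʳ (*-congʳ (𝟙-cong (x ≟ᵥ y) (y ≟ᵥ x) ≡.sym ≡.sym))) ⟩
    (𝟙 (y ≟ᵥ x) * fromNat (degree y) - 𝟙 (adjacent? y x)) * a ⁻¹     ≈⟨ laplacian-entry a y x ⟨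
    laplacian m n a y x                                              ∎
    where open ≈-Reasoning

  gradient : Carrier → (Vertex → Carrier) → GridEdge → Carrier
  gradient a φ e = drop φ e / a

  infixr 7 _·ᵥ_
  _·ᵥ_ : (Vertex → Vertex → Carrier) → (Vertex → Carrier) → Vertex → Carrier
  (A ·ᵥ φ) x = ∑[ y ← vertices ] A x y * φ y

  -- The factorisation of the Laplacian through the incidence matrix. Writing the degree as a sum of
  -- adjacencies turns a row into a sum of `φ x - φ y` over neighbours; writing adjacency as a sum
  -- over edges then leaves only the two ends of each edge.
  laplacian-divergence : ∀ a φ x → (laplacian m n a ·ᵥ φ) x ≈ divergence (gradient a φ) x
  laplacian-divergence a φ x = begin
    (∑[ y ← vertices ] laplacian m n a x y * φ y)
      ≈⟨ ∑-cong vertices (λ y → trans (*-congʳ (laplacian-entry a x y))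
           (solve 5 (λ i d α r f → (i :* d :- α) :* r :* f := r :* (i :* (d :* f) :- α :* f)) refl
             (𝟙 (x ≟ᵥ y)) (fromNat (degree x)) (𝟙 (adjacent? x y)) (a ⁻¹) (φ y))) ⟩
    (∑[ y ← vertices ] a ⁻¹ * (𝟙 (x ≟ᵥ y) * (fromNat (degree x) * φ y) - 𝟙 (adjacent? x y) * φ y))
      ≈⟨ *-distribˡ-∑ vertices (a ⁻¹) _ ⟨
    a ⁻¹ * (∑[ y ← vertices ] (𝟙 (x ≟ᵥ y) * (fromNat (degree x) * φ y) - 𝟙 (adjacent? x y) * φ y))
      ≈⟨ *-congˡ (∑-minus vertices _ _) ⟩
    a ⁻¹ * ((∑[ y ← vertices ] 𝟙 (x ≟ᵥ y) * (fromNat (degree x) * φ y)) - (∑[ y ← vertices ] 𝟙 (adjacent? x y) * φ y))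
      ≈⟨ *-congˡ (+-congʳ (∑-sift x (λ y → fromNat (degree x) * φ y))) ⟩
    a ⁻¹ * (fromNat (degree x) * φ x - (∑[ y ← vertices ] 𝟙 (adjacent? x y) * φ y))
      ≈⟨ *-congˡ (+-congʳ (trans (*-congʳ (degree-sum x)) (*-distribʳ-∑ vertices (φ x) _))) ⟩
    a ⁻¹ * ((∑[ y ← vertices ] 𝟙 (adjacent? x y) * φ x) - (∑[ y ← vertices ] 𝟙 (adjacent? x y) * φ y))
      ≈⟨ *-congˡ (∑-minus vertices _ _) ⟨
    a ⁻¹ * (∑[ y ← vertices ] (𝟙 (adjacent? x y) * φ x - 𝟙 (adjacent? x y) * φ y))
      ≈⟨ *-congˡ (∑-cong vertices (λ y → trans
           (solve 3 (λ α p r → α :* p :- α :* r := α :* (p :- r)) refl (𝟙 (adjacent? x y)) (φ x) (φ y))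
           (trans (*-congʳ (adjacency x y)) (*-distribʳ-∑ gridEdges _ _)))) ⟩
    a ⁻¹ * (∑[ y ← vertices ] ∑[ e ← gridEdges ]
      (𝟙 (gridTail e ≟ᵥ x) * 𝟙 (gridHead e ≟ᵥ y) + 𝟙 (gridHead e ≟ᵥ x) * 𝟙 (gridTail e ≟ᵥ y)) * (φ x - φ y))
      ≈⟨ *-congˡ (∑-comm vertices gridEdges _) ⟩
    a ⁻¹ * (∑[ e ← gridEdges ] ∑[ y ← vertices ]
      (𝟙 (gridTail e ≟ᵥ x) * 𝟙 (gridHead e ≟ᵥ y) + 𝟙 (gridHead e ≟ᵥ x) * 𝟙 (gridTail e ≟ᵥ y)) * (φ x - φ y))
      ≈⟨ *-distribˡ-∑ gridEdges (a ⁻¹) _ ⟩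
    (∑[ e ← gridEdges ] a ⁻¹ * (∑[ y ← vertices ]
      (𝟙 (gridTail e ≟ᵥ x) * 𝟙 (gridHead e ≟ᵥ y) + 𝟙 (gridHead e ≟ᵥ x) * 𝟙 (gridTail e ≟ᵥ y)) * (φ x - φ y)))
      ≈⟨ ∑-cong gridEdges (λ e → trans (*-congˡ (edge-term e))
           (solve 4 (λ r δ T H → r :* (T :* δ :- H :* δ) := δ :* r :* (T :- H)) refl
             (a ⁻¹) (drop φ e) (𝟙 (gridTail e ≟ᵥ x)) (𝟙 (gridHead e ≟ᵥ x)))) ⟩
    divergence (gradient a φ) x ∎
    where
    open ≈-Reasoning
    edge-term : ∀ e →
      (∑[ y ← vertices ] (𝟙 (gridTail e ≟ᵥ x) * 𝟙 (gridHead e ≟ᵥ y) + 𝟙 (gridHead e ≟ᵥ x) * 𝟙 (gridTail e ≟ᵥ y)) * (φ x - φ y)) ≈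
      𝟙 (gridTail e ≟ᵥ x) * drop φ e - 𝟙 (gridHead e ≟ᵥ x) * drop φ e
    edge-term e = begin
      (∑[ y ← vertices ] (T * 𝟙 (gridHead e ≟ᵥ y) + H * 𝟙 (gridTail e ≟ᵥ y)) * (φ x - φ y))
        ≈⟨ ∑-cong vertices (λ y → solve 5 (λ T h H t δ → (T :* h :+ H :* t) :* δ := h :* (T :* δ) :+ t :* (H :* δ)) refl
             T (𝟙 (gridHead e ≟ᵥ y)) H (𝟙 (gridTail e ≟ᵥ y)) (φ x - φ y)) ⟩
      (∑[ y ← vertices ] (𝟙 (gridHead e ≟ᵥ y) * (T * (φ x - φ y)) + 𝟙 (gridTail e ≟ᵥ y) * (H * (φ x - φ y))))
        ≈⟨ ∑-+ vertices _ _ ⟩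
      (∑[ y ← vertices ] 𝟙 (gridHead e ≟ᵥ y) * (T * (φ x - φ y))) + (∑[ y ← vertices ] 𝟙 (gridTail e ≟ᵥ y) * (H * (φ x - φ y)))
        ≈⟨ +-cong (∑-sift (gridHead e) (λ y → T * (φ x - φ y))) (∑-sift (gridTail e) (λ y → H * (φ x - φ y))) ⟩
      T * (φ x - φ (gridHead e)) + H * (φ x - φ (gridTail e))
        ≈⟨ +-cong (𝟙-sift (gridTail e) x (λ z → φ z - φ (gridHead e))) (𝟙-sift (gridHead e) x (λ z → φ z - φ (gridTail e))) ⟩
      T * (φ (gridTail e) - φ (gridHead e)) + H * (φ (gridHead e) - φ (gridTail e))
        ≈⟨ solve 4 (λ T H p r → T :* (p :- r) :+ H :* (r :- p) := T :* (p :- r) :- H :* (p :- r)) refl T H (φ (gridTail e)) (φ (gridHead e)) ⟩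
      T * drop φ e - H * drop φ e ∎
      where
      T = 𝟙 (gridTail e ≟ᵥ x)
      H = 𝟙 (gridHead e ≟ᵥ x)

  -- Summation by parts: after exchanging the sums, each edge meets only its tail and its head.
  green : ∀ (π : Vertex → Carrier) f → (∑[ x ← vertices ] π x * divergence f x) ≈ (∑[ e ← gridEdges ] f e * drop π e)
  green π f = begin
    (∑[ x ← vertices ] π x * divergence f x)
      ≈⟨ ∑-cong vertices (λ x → *-distribˡ-∑ gridEdges (π x) _) ⟩
    (∑[ x ← vertices ] ∑[ e ← gridEdges ] π x * (f e * (𝟙 (gridTail e ≟ᵥ x) - 𝟙 (gridHead e ≟ᵥ x))))
      ≈⟨ ∑-comm vertices gridEdges _ ⟩
    (∑[ e ← gridEdges ] ∑[ x ← vertices ] π x * (f e * (𝟙 (gridTail e ≟ᵥ x) - 𝟙 (gridHead e ≟ᵥ x))))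
      ≈⟨ ∑-cong gridEdges (λ e → begin
           (∑[ x ← vertices ] π x * (f e * (𝟙 (gridTail e ≟ᵥ x) - 𝟙 (gridHead e ≟ᵥ x))))
             ≈⟨ ∑-cong vertices (λ x → solve 4 (λ p f T H → p :* (f :* (T :- H)) := T :* (f :* p) :- H :* (f :* p)) refl
                  (π x) (f e) (𝟙 (gridTail e ≟ᵥ x)) (𝟙 (gridHead e ≟ᵥ x))) ⟩
           (∑[ x ← vertices ] (𝟙 (gridTail e ≟ᵥ x) * (f e * π x) - 𝟙 (gridHead e ≟ᵥ x) * (f e * π x)))
             ≈⟨ ∑-minus vertices _ _ ⟩
           (∑[ x ← vertices ] 𝟙 (gridTail e ≟ᵥ x) * (f e * π x)) - (∑[ x ← vertices ] 𝟙 (gridHead e ≟ᵥ x) * (f e * π x))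
             ≈⟨ +-cong (∑-sift (gridTail e) (λ x → f e * π x)) (-‿cong (∑-sift (gridHead e) (λ x → f e * π x))) ⟩
           f e * π (gridTail e) - f e * π (gridHead e)
             ≈⟨ solve 3 (λ f p r → f :* p :- f :* r := f :* (p :- r)) refl (f e) (π (gridTail e)) (π (gridHead e)) ⟩
           f e * drop π e ∎) ⟩
    (∑[ e ← gridEdges ] f e * drop π e) ∎
    where open ≈-Reasoning

  -- Pairing `φ` with its zero Laplacian shows that the energy, a sum of squared drops divided by
  -- `a`, vanishes. So every drop is zero, and every vertex is joined to `s` by a row and a column.
  harmonic⇒constant : ∀ {a φ} → 0# < a → (∀ x → (laplacian m n a ·ᵥ φ) x ≈ 0#) → ∀ x y → φ x ≈ φ y
  harmonic⇒constant {a} {φ} 0<a Lφ≈0 x y = trans (to-s x) (sym (to-s y))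
    where
    energy : (∑[ e ← gridEdges ] gradient a φ e * drop φ e) ≈ 0#
    energy = trans (sym (green φ (gradient a φ))) (∑-zero vertices (λ x →
      trans (*-congˡ (trans (sym (laplacian-divergence a φ x)) (Lφ≈0 x))) (zeroʳ _)))

    rearranged : ∀ e → a ⁻¹ * (drop φ e * drop φ e) ≈ gradient a φ e * drop φ e
    rearranged e = solve 2 (λ r d → r :* (d :* d) := d :* r :* d) refl (a ⁻¹) (drop φ e)

    drop≈0 : ∀ e → drop φ e ≈ 0#
    drop≈0 e with drop φ e ≟ 0#
    ... | yes eq = eq
    ... | no neq = contradiction
      (<-respʳ-≈ energy (<-≤-trans
        (<-respʳ-≈ (rearranged e) (*-pos (0<x⇒0<x⁻¹ 0<a) (x≉0⇒0<x² neq)))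
        (∑-∈-≤ (λ e → ≤-respʳ-≈ (rearranged e) (*-nonneg (<⇒≤ (0<x⇒0<x⁻¹ 0<a)) (square-nonneg _))) (gridEdges-complete e))))
      (<-irrefl refl)

    step : ∀ e → φ (gridHead e) ≈ φ (gridTail e)
    step e = begin
      φ (gridHead e)                ≈⟨ solve 2 (λ p r → r := p :- (p :- r)) refl (φ (gridTail e)) (φ (gridHead e)) ⟩
      φ (gridTail e) - drop φ e     ≈⟨ +-congˡ (-‿cong (drop≈0 e)) ⟩
      φ (gridTail e) - 0#           ≈⟨ solve 1 (λ p → p :- con (+ 0) := p) refl (φ (gridTail e)) ⟩
      φ (gridTail e)                ∎
      where open ≈-Reasoning

    line : ∀ k (g : Fin (suc k) → Carrier) → (∀ i → g (suc i) ≈ g (inject₁ i)) → ∀ i → g i ≈ g zero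
    line k       g eq zero    = refl
    line (suc k) g eq (suc i) = trans (line k (λ i → g (suc i)) (λ i → eq (suc i)) i) (eq zero)

    to-s : ∀ x → φ x ≈ φ s
    to-s (i , j) = trans (line m (λ i → φ (i , j)) (λ i → step (inj₁ (i , j))) i)
                         (line n (λ j → φ (zero , j)) (λ j → step (inj₂ (zero , j))) j)

-- Dipole potentials from the Moore-Penrose inverse.

module Pseudoinverse (ℝ : Reals) (m n : ℕ) where
  open Reals ℝ hiding (zero)
  open Flow ℝ
  open Grid m n
  open IntegerRingSolver ℝ
  open OrderedField ℝ
  open Sums ℝ
  open Laplacian ℝ m n

  module _ {a : Carrier} (0<a : 0# < a) {X : Vertex → Vertex → Carrier}
           (mp : IsMoorePenroseInverse m n (laplacian m n a) X) where

    private
      L = laplacian m n a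

      P : Vertex → Vertex → Carrier
      P x y = ∑[ z ← vertices ] L x z * X z y

      P-sym : ∀ x y → P y x ≈ P x y
      P-sym = IsMoorePenroseInverse.AX-symmetric mp

      -- The entries of I - LX, in substance the orthogonal projection onto the constants.
      defect : Vertex → Vertex → Carrier
      defect x y = 𝟙 (y ≟ᵥ x) - P x y

      defect-sym : ∀ x y → defect x y ≈ defect y x
      defect-sym x y = +-cong (𝟙-cong (y ≟ᵥ x) (x ≟ᵥ y) ≡.sym ≡.sym) (-‿cong (sym (P-sym x y)))

      -- Since `L` and LX are symmetric, transposition turns L(LX) into (LX)L, which is `L` by the
      -- first Penrose equation.
      defect-harmonic : ∀ y x → (L ·ᵥ (λ z → defect z y)) x ≈ 0#
      defect-harmonic y x = begin
        (∑[ z ← vertices ] L x z * (𝟙 (y ≟ᵥ z) - P z y))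
          ≈⟨ ∑-cong vertices (λ z → trans
               (solve 3 (λ l i p → l :* (i :- p) := i :* l :- p :* l) refl (L x z) (𝟙 (y ≟ᵥ z)) (P z y))
               (+-congˡ (-‿cong (*-cong (P-sym y z) (laplacian-sym a x z))))) ⟩
        (∑[ z ← vertices ] (𝟙 (y ≟ᵥ z) * L x z - P y z * L z x))
          ≈⟨ ∑-minus vertices _ _ ⟩
        (∑[ z ← vertices ] 𝟙 (y ≟ᵥ z) * L x z) - (∑[ z ← vertices ] P y z * L z x)
          ≈⟨ +-cong (trans (∑-sift y (L x)) (laplacian-sym a x y)) (-‿cong (IsMoorePenroseInverse.AXA≋A mp y x)) ⟩
        L y x - L y x
          ≈⟨ -‿inverseʳ _ ⟩
        0# ∎
        where open ≈-Reasoning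

      defect-constant : ∀ x p r → defect x p ≈ defect x r
      defect-constant x p r = begin
        defect x p ≈⟨ defect-sym x p ⟩
        defect p x ≈⟨ harmonic⇒constant 0<a (defect-harmonic x) p r ⟩
        defect r x ≈⟨ defect-sym r x ⟩
        defect x r ∎
        where open ≈-Reasoning

    -- The potential of a unit current entering at `p` and leaving at `r`.
    dipole : Vertex → Vertex → Vertex → Carrier
    dipole p r x = X x p - X x r

    -- LX differs from the identity by `defect`, whose rows are constant; the difference of two
    -- columns cancels it.
    laplacian-dipole : ∀ p r x → (laplacian m n a ·ᵥ dipole p r) x ≈ 𝟙 (p ≟ᵥ x) - 𝟙 (r ≟ᵥ x)
    laplacian-dipole p r x = begin
      (∑[ z ← vertices ] L x z * (X z p - X z r))
        ≈⟨ ∑-cong vertices (λ z → solve 3 (λ l a b → l :* (a :- b) := l :* a :- l :* b) refl (L x z) (X z p) (X z r)) ⟩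
      (∑[ z ← vertices ] (L x z * X z p - L x z * X z r))
        ≈⟨ ∑-minus vertices _ _ ⟩
      P x p - P x r
        ≈⟨ solve 4 (λ i j p r → p :- r := (j :- r) :- (i :- p) :+ (i :- j)) refl (𝟙 (p ≟ᵥ x)) (𝟙 (r ≟ᵥ x)) (P x p) (P x r) ⟩
      defect x r - defect x p + (𝟙 (p ≟ᵥ x) - 𝟙 (r ≟ᵥ x))
        ≈⟨ +-congʳ (trans (+-congʳ (defect-constant x r p)) (-‿inverseʳ _)) ⟩
      0# + (𝟙 (p ≟ᵥ x) - 𝟙 (r ≟ᵥ x))
        ≈⟨ +-identityˡ _ ⟩
      𝟙 (p ≟ᵥ x) - 𝟙 (r ≟ᵥ x) ∎
      where open ≈-Reasoning

    divergence-dipole : ∀ p r x → divergence (gradient a (dipole p r)) x ≈ 𝟙 (p ≟ᵥ x) - 𝟙 (r ≟ᵥ x)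
    divergence-dipole p r x = trans (sym (laplacian-divergence a (dipole p r) x)) (laplacian-dipole p r x)

    voltage-dipole : ∀ q u v → voltage m n X q u v ≈ q * (dipole u v s - dipole u v t)
    voltage-dipole q u v = *-congˡ (begin
      (∑[ x ← vertices ] ∑[ y ← vertices ] (𝟙 (s ≟ᵥ x) - 𝟙 (t ≟ᵥ x)) * X x y * (𝟙 (u ≟ᵥ y) - 𝟙 (v ≟ᵥ y)))
        ≈⟨ ∑-cong vertices (λ x → begin
             (∑[ y ← vertices ] (𝟙 (s ≟ᵥ x) - 𝟙 (t ≟ᵥ x)) * X x y * (𝟙 (u ≟ᵥ y) - 𝟙 (v ≟ᵥ y)))
               ≈⟨ ∑-cong vertices (λ y → solve 4 (λ b X i j → b :* X :* (i :- j) := b :* (i :* X :- j :* X)) refl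
                    (𝟙 (s ≟ᵥ x) - 𝟙 (t ≟ᵥ x)) (X x y) (𝟙 (u ≟ᵥ y)) (𝟙 (v ≟ᵥ y))) ⟩
             (∑[ y ← vertices ] (𝟙 (s ≟ᵥ x) - 𝟙 (t ≟ᵥ x)) * (𝟙 (u ≟ᵥ y) * X x y - 𝟙 (v ≟ᵥ y) * X x y))
               ≈⟨ *-distribˡ-∑ vertices _ _ ⟨
             (𝟙 (s ≟ᵥ x) - 𝟙 (t ≟ᵥ x)) * (∑[ y ← vertices ] (𝟙 (u ≟ᵥ y) * X x y - 𝟙 (v ≟ᵥ y) * X x y))
               ≈⟨ *-congˡ (trans (∑-minus vertices _ _) (+-cong (∑-sift u (X x)) (-‿cong (∑-sift v (X x))))) ⟩
             (𝟙 (s ≟ᵥ x) - 𝟙 (t ≟ᵥ x)) * dipole u v x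
               ≈⟨ solve 3 (λ i j d → (i :- j) :* d := i :* d :- j :* d) refl (𝟙 (s ≟ᵥ x)) (𝟙 (t ≟ᵥ x)) (dipole u v x) ⟩
             𝟙 (s ≟ᵥ x) * dipole u v x - 𝟙 (t ≟ᵥ x) * dipole u v x ∎) ⟩
      (∑[ x ← vertices ] (𝟙 (s ≟ᵥ x) * dipole u v x - 𝟙 (t ≟ᵥ x) * dipole u v x))
        ≈⟨ trans (∑-minus vertices _ _) (+-cong (∑-sift s (dipole u v)) (-‿cong (∑-sift t (dipole u v)))) ⟩
      dipole u v s - dipole u v t ∎)
      where open ≈-Reasoning

-- A discrete minimum principle for h(i,j) = Φ(i,j) − Φ(i+1,j).  Indices are shifted by one, so that
-- index 0 and the last index are ghost copies of the boundary lines: h vanishes on the ghost rows and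
-- is reflected in the ghost columns.
module Monotonicity (ℝ : Reals) where
  open Reals ℝ hiding (zero)
  open IntegerRingSolver ℝ
  open OrderedField ℝ
  open Sums ℝ

  module Difference (Φ σ : ℕ → ℕ → Carrier) (m n : ℕ)
    (low   : ∀ j → Φ 0 j ≈ Φ 1 j) (high  : ∀ j → Φ (suc m) j ≈ Φ (suc (suc m)) j)
    (left  : ∀ i → Φ i 0 ≈ Φ i 1) (right : ∀ i → Φ i (suc (suc n)) ≈ Φ i (suc n))
    (five-point : ∀ {k l} → k ℕ.≤ m → l ℕ.≤ n →
       Φ (suc k) (suc l) - Φ (suc (suc k)) (suc l) - (Φ k (suc l) - Φ (suc k) (suc l)) +
       (Φ (suc k) (suc l) - Φ (suc k) (suc (suc l)) - (Φ (suc k) l - Φ (suc k) (suc l))) ≈ σ k l)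
    (σ-corner : 0# < σ 0 0) (σ-nonneg : ∀ {k l} → k ℕ.< m → l ℕ.≤ n → 0# ≤ σ k l)
    (σ-nonpos : ∀ {k l} → k ℕ.< m → l ℕ.≤ n → σ (suc k) l ≤ 0#) where

    h : ℕ → ℕ → Carrier
    h i j = Φ i j - Φ (suc i) j

    excess : ℕ → ℕ → Carrier
    excess k l = σ k l - σ (suc k) l

    -- The five-point equation at `(k , l)` minus the one at `(suc k , l)`, solved for the centre.
    -- The excess is the contribution of the sources.
    superharmonic : ∀ {k l} → k ℕ.< m → l ℕ.≤ n →
      h (suc k) (suc l) + h (suc k) (suc l) + h (suc k) (suc l) + h (suc k) (suc l) ≈
      excess k l + (h k (suc l) + h (suc (suc k)) (suc l) + h (suc k) l + h (suc k) (suc (suc l)))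
    superharmonic {k} {l} k<m l≤n = begin
      _ ≈⟨ solve 9 (λ Φ₀ Φ₁ Φ₂ Φ₃ b₁ b₂ c₁ c₂ z →
             let h₁ = Φ₁ :- Φ₂ in
             h₁ :+ h₁ :+ h₁ :+ h₁ :=
             (Φ₁ :- Φ₂ :- (Φ₀ :- Φ₁) :+ (Φ₁ :- c₁ :- (b₁ :- Φ₁))) :- (Φ₂ :- Φ₃ :- (Φ₁ :- Φ₂) :+ (Φ₂ :- c₂ :- (b₂ :- Φ₂)))
             :+ (Φ₀ :- Φ₁ :+ (Φ₂ :- Φ₃) :+ (b₁ :- b₂) :+ (c₁ :- c₂))) refl
           (Φ k (suc l)) (Φ (suc k) (suc l)) (Φ (suc (suc k)) (suc l)) (Φ (suc (suc (suc k))) (suc l))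
           (Φ (suc k) l) (Φ (suc (suc k)) l) (Φ (suc k) (suc (suc l))) (Φ (suc (suc k)) (suc (suc l))) 0# ⟩
      _ ≈⟨ +-congʳ (+-cong (five-point (ℕ.<⇒≤ k<m) l≤n) (-‿cong (five-point k<m l≤n))) ⟩
      _ ∎
      where open ≈-Reasoning

    excess-nonneg : ∀ {k l} → k ℕ.< m → l ℕ.≤ n → 0# ≤ excess k l
    excess-nonneg k<m l≤n = x≤y⇒0≤y-x (≤-trans (σ-nonpos k<m l≤n) (σ-nonneg k<m l≤n))

    -- Here `μ` stands for a minimum of `h` assumed nonpositive, to be refuted. Its sign extends the
    -- lower bound to the ghost rows, where `h` vanishes.
    module _ {μ : Carrier} (μ≤0 : μ ≤ 0#) (μ≤h : ∀ {k l} → k ℕ.< m → l ℕ.≤ n → μ ≤ h (suc k) (suc l)) where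

      private
        μ≤h-rows : ∀ {k l} → k ℕ.≤ suc m → l ℕ.≤ n → μ ≤ h k (suc l)
        μ≤h-rows {zero}  {l} _ _ = ≤-respʳ-≈ (sym (trans (+-congʳ (low (suc l))) (-‿inverseʳ _))) μ≤0
        μ≤h-rows {suc k} {l} k≤m l≤n with ℕ.m≤n⇒m<n∨m≡n (ℕ.s≤s⁻¹ k≤m)
        ... | inj₁ k<m    = μ≤h k<m l≤n
        ... | inj₂ ≡.refl = ≤-respʳ-≈ (sym (trans (+-congʳ (high (suc l))) (-‿inverseʳ _))) μ≤0

        μ≤h-cols : ∀ {k l} → k ℕ.< m → l ℕ.≤ suc (suc n) → μ ≤ h (suc k) l
        μ≤h-cols {k} {zero}  k<m _ = ≤-respʳ-≈ (sym (+-cong (left _) (-‿cong (left _)))) (μ≤h k<m z≤n)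
        μ≤h-cols {k} {suc l} k<m l≤ with ℕ.m≤n⇒m<n∨m≡n (ℕ.s≤s⁻¹ l≤)
        ... | inj₁ l<n    = μ≤h k<m (ℕ.s≤s⁻¹ l<n)
        ... | inj₂ ≡.refl = ≤-respʳ-≈ (sym (+-cong (right _) (-‿cong (right _)))) (μ≤h k<m ℕ.≤-refl)

        -- If the centre is at most `μ` and three neighbours are at least `μ`, then
        -- `4μ ≥ 4h ≥ a + 3μ`, so the fourth neighbour `a` is at most `μ`.
        squeeze : ∀ {h e a b c d S} → h + h + h + h ≈ e + S → S ≈ a + (b + c + d) →
                  0# ≤ e → h ≤ μ → μ ≤ b → μ ≤ c → μ ≤ d → a ≤ μ
        squeeze {h} {e} {a} {b} {c} {d} {S} 4h S≈ 0≤e h≤μ μ≤b μ≤c μ≤d = 0≤y-x⇒x≤y (≤-respʳ-≈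
          (begin
            e + ((μ - h) + (μ - h) + (μ - h) + (μ - h)) + ((b - μ) + (c - μ) + (d - μ))
              ≈⟨ solve 6 (λ e μ h b c d → e :+ ((μ :- h) :+ (μ :- h) :+ (μ :- h) :+ (μ :- h)) :+ ((b :- μ) :+ (c :- μ) :+ (d :- μ))
                   := μ :+ (e :+ (b :+ c :+ d)) :- (h :+ h :+ h :+ h)) refl e μ h b c d ⟩
            μ + (e + (b + c + d)) - (h + h + h + h)
              ≈⟨ +-congˡ (-‿cong (trans 4h (+-congˡ S≈))) ⟩
            μ + (e + (b + c + d)) - (e + (a + (b + c + d)))
              ≈⟨ solve 4 (λ μ e s a → μ :+ (e :+ s) :- (e :+ (a :+ s)) := μ :- a) refl μ e (b + c + d) a ⟩
            μ - a ∎)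
          (+-nonneg (+-nonneg 0≤e (+-nonneg (+-nonneg (+-nonneg p p) p) p))
                    (+-nonneg (+-nonneg (x≤y⇒0≤y-x μ≤b) (x≤y⇒0≤y-x μ≤c)) (x≤y⇒0≤y-x μ≤d))))
          where
          open ≈-Reasoning
          p = x≤y⇒0≤y-x h≤μ

        -- A minimum passes to its neighbours. It is carried to row `1`, and then along that row to
        -- the corner, where the source makes the excess strictly positive.
        to-first-row : ∀ {k l} → k ℕ.< m → l ℕ.≤ n → h (suc k) (suc l) ≤ μ → h 1 (suc l) ≤ μ
        to-first-row {zero}  _   _   le = le
        to-first-row {suc k} k<m l≤n le = to-first-row (ℕ.<⇒≤ k<m) l≤n
          (squeeze (superharmonic k<m l≤n)
            (solve 4 (λ a b c d → a :+ b :+ c :+ d := a :+ (b :+ c :+ d)) refl _ _ _ _)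
            (excess-nonneg k<m l≤n) le (μ≤h-rows (s≤s k<m) l≤n) (μ≤h-cols k<m (ℕ.m≤n⇒m≤1+n (ℕ.m≤n⇒m≤1+n l≤n))) (μ≤h-cols k<m (s≤s (s≤s l≤n))))

        to-corner : ∀ {l} → 0 ℕ.< m → l ℕ.≤ n → h 1 (suc l) ≤ μ → h 1 1 ≤ μ
        to-corner {zero}  _   _   le = le
        to-corner {suc l} 0<m l≤n le = to-corner 0<m (ℕ.<⇒≤ l≤n)
          (squeeze (superharmonic 0<m l≤n)
            -- The reordering singles out the neighbour one column closer to the corner.
            (solve 4 (λ a b c d → a :+ b :+ c :+ d := c :+ (a :+ b :+ d)) refl _ _ _ _)
            (excess-nonneg 0<m l≤n) le (μ≤h-rows z≤n l≤n) (μ≤h-rows (s≤s 0<m) l≤n) (μ≤h-cols 0<m (s≤s (s≤s l≤n))))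

        corner-absurd : 0 ℕ.< m → ¬ (h 1 1 ≤ μ)
        corner-absurd 0<m le = <-irrefl refl (begin-strict
          h 1 1 + h 1 1 + h 1 1 + h 1 1   ≤⟨ +-mono-≤ (+-mono-≤ (+-mono-≤ le le) le) le ⟩
          μ + μ + μ + μ                   ≤⟨ +-mono-≤ (+-mono-≤ (+-mono-≤ (μ≤h-rows z≤n z≤n) (μ≤h-rows (s≤s 0<m) z≤n))
                                               (μ≤h-cols 0<m z≤n)) (μ≤h-cols 0<m (s≤s (s≤s z≤n))) ⟩
          h 0 1 + h 2 1 + h 1 0 + h 1 2   ≈⟨ +-identityˡ _ ⟨
          0# + (h 0 1 + h 2 1 + h 1 0 + h 1 2) <⟨ +-monoˡ-< _ (x<y⇒0<y-x (≤-<-trans (σ-nonpos 0<m z≤n) σ-corner)) ⟩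
          excess 0 0 + (h 0 1 + h 2 1 + h 1 0 + h 1 2) ≈⟨ superharmonic 0<m z≤n ⟨
          h 1 1 + h 1 1 + h 1 1 + h 1 1   ∎)
          where open ≤-Reasoning

      not-attained : ∀ {k l} → k ℕ.< m → l ℕ.≤ n → ¬ (h (suc k) (suc l) ≤ μ)
      not-attained k<m l≤n le = corner-absurd 0<m (to-corner 0<m l≤n (to-first-row k<m l≤n le))
        where 0<m = ℕ.≤-<-trans z≤n k<m

    h-positive : ∀ {k l} → k ℕ.< m → l ℕ.≤ n → 0# < h (suc k) (suc l)
    h-positive {k} {l} k<m l≤n with argmin (λ (k , l) → h (suc k) (suc l))
                                     (∈-cartesianProduct⁺ (∈-upTo⁺ k<m) (∈-upTo⁺ (s≤s l≤n)))
    ... | (k₀ , l₀) , ∈₀ , min with 0# <? h (suc k₀) (suc l₀)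
    ... | yes pos = <-≤-trans pos (min (∈-cartesianProduct⁺ (∈-upTo⁺ k<m) (∈-upTo⁺ (s≤s l≤n))))
    -- The minimum itself serves as `μ`; it is attained, against `not-attained`.
    ... | no ¬pos = contradiction ≤-refl
            (not-attained (≮⇒≥ ¬pos) (λ k<m l≤n → min (∈-cartesianProduct⁺ (∈-upTo⁺ k<m) (∈-upTo⁺ (s≤s l≤n))))
              (∈-upTo⁻ (proj₁ (∈-cartesianProduct⁻ _ _ ∈₀))) (ℕ.s≤s⁻¹ (∈-upTo⁻ (proj₂ (∈-cartesianProduct⁻ (upTo m) _ ∈₀)))))

-- Positivity of the electric flow on every grid edge.

module ElectricFlow (ℝ : Reals) (m n : ℕ) where
  open Reals ℝ hiding (zero)
  open Flow ℝ
  open Grid m n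
  open GridGraph m n
  open IntegerRingSolver ℝ
  open OrderedField ℝ
  open Sums ℝ
  open Laplacian ℝ m n
  open Monotonicity ℝ

  -- Truncation makes the index just beyond the end a copy of the last one, as `ℕ.pred` does below
  -- zero. These copies are the ghost lines of the minimum principle.
  clamp : ∀ k → ℕ → Fin (suc k)
  clamp k i = fromℕ< (s≤s (ℕ.m⊓n≤n i k))

  toℕ-clamp : ∀ k i → toℕ (clamp k i) ≡ i ℕ.⊓ k
  toℕ-clamp k i = Fin.toℕ-fromℕ< _

  clamp-≡ : ∀ {k i} (x : Fin (suc k)) → i ℕ.⊓ k ≡ toℕ x → clamp k i ≡ x
  clamp-≡ {k} {i} x eq = Fin.toℕ-injective (≡.trans (toℕ-clamp k i) eq)

  clamp-toℕ : ∀ {k} (x : Fin (suc k)) → clamp k (toℕ x) ≡ x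
  clamp-toℕ x = clamp-≡ x (ℕ.m≤n⇒m⊓n≡m (Fin.toℕ≤pred[n] x))

  clamp-inject₁ : ∀ {k} (x : Fin k) → clamp k (toℕ x) ≡ inject₁ x
  clamp-inject₁ {k} x = clamp-≡ (inject₁ x) (≡.trans (ℕ.m≤n⇒m⊓n≡m (ℕ.<⇒≤ (Fin.toℕ<n x))) (≡.sym (Fin.toℕ-inject₁ x)))

  clamp-suc : ∀ {k} (x : Fin k) → clamp k (suc (toℕ x)) ≡ suc x
  clamp-suc x = clamp-≡ (suc x) (ℕ.m≤n⇒m⊓n≡m (Fin.toℕ<n x))

  clamp-beyond : ∀ k → clamp k (suc k) ≡ clamp k k
  clamp-beyond k = clamp-≡ (clamp k k) (≡.trans (ℕ.m≥n⇒m⊓n≡n (ℕ.n≤1+n k))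
    (≡.sym (≡.trans (toℕ-clamp k k) (ℕ.⊓-idem k))))

  -- The Laplacian of a path. At an end, the missing edge gives an empty contribution on the left
  -- and a clamped difference equal to zero on the right, so one formula serves all positions.
  second-difference : ∀ k (g : Fin (suc k) → Carrier) {i} → i ℕ.≤ k →
    (∑[ x ← allFin k ] (g (inject₁ x) - g (suc x)) * (𝟙 (inject₁ x Fin.≟ clamp k i) - 𝟙 (suc x Fin.≟ clamp k i))) ≈
    g (clamp k i) - g (clamp k (suc i)) - (g (clamp k (ℕ.pred i)) - g (clamp k i))
  second-difference k g {i} i≤k = begin
    _ ≈⟨ ∑-cong (allFin k) (λ x → solve 3 (λ d a b → d :* (a :- b) := a :* d :- b :* d) refl
           (g (inject₁ x) - g (suc x)) (𝟙 (inject₁ x Fin.≟ clamp k i)) (𝟙 (suc x Fin.≟ clamp k i))) ⟩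
    _ ≈⟨ ∑-minus (allFin k) _ _ ⟩
    _ ≈⟨ +-cong (outgoing (ℕ.m≤n⇒m<n∨m≡n i≤k)) (-‿cong (incoming i≤k)) ⟩
    _ ∎
    where
    open ≈-Reasoning

    d : Fin k → Carrier
    d x = g (inject₁ x) - g (suc x)

    at : ∀ {i} (i<k : i ℕ.< k) → d (fromℕ< i<k) ≈ g (clamp k i) - g (clamp k (suc i))
    at i<k = reflexive (≡.cong₂ (λ x y → g x - g y)
      (≡.trans (≡.sym (clamp-inject₁ (fromℕ< i<k))) (≡.cong (clamp k) (Fin.toℕ-fromℕ< i<k)))
      (≡.trans (≡.sym (clamp-suc (fromℕ< i<k))) (≡.cong (λ i → clamp k (suc i)) (Fin.toℕ-fromℕ< i<k))))

    outgoing : ∀ {i} → i ℕ.< k ⊎ i ≡ k →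
      (∑[ x ← allFin k ] 𝟙 (inject₁ x Fin.≟ clamp k i) * d x) ≈ g (clamp k i) - g (clamp k (suc i))
    outgoing {i} (inj₁ i<k) = trans
      (∑-𝟙-unique (λ x → inject₁ x Fin.≟ clamp k i) d (Unique.allFin⁺ k) (∈-allFin (fromℕ< i<k)) hit
        (λ p → Fin.inject₁-injective (≡.trans p (≡.sym hit))))
      (at i<k)
      where
      hit : inject₁ (fromℕ< i<k) ≡ clamp k i
      hit = ≡.trans (≡.sym (clamp-inject₁ (fromℕ< i<k))) (≡.cong (clamp k) (Fin.toℕ-fromℕ< i<k))
    outgoing (inj₂ ≡.refl) = trans
      (∑-𝟙-none (λ x → inject₁ x Fin.≟ clamp k k) (allFin k) d (All.universal (λ x p → ℕ.<-irrefl
        (≡.trans (≡.sym (Fin.toℕ-inject₁ x)) (≡.trans (≡.cong toℕ p) (≡.trans (toℕ-clamp k k) (ℕ.⊓-idem k)))) (Fin.toℕ<n x)) (allFin k)))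
      (sym (trans (+-congˡ (-‿cong (reflexive (≡.cong g (clamp-beyond k))))) (-‿inverseʳ _)))

    incoming : ∀ {i} → i ℕ.≤ k →
      (∑[ x ← allFin k ] 𝟙 (suc x Fin.≟ clamp k i) * d x) ≈ g (clamp k (ℕ.pred i)) - g (clamp k i)
    incoming {zero}  _   = trans
      (∑-𝟙-none (λ x → suc x Fin.≟ clamp k 0) (allFin k) d (All.universal (λ x ()) (allFin k)))
      (sym (-‿inverseʳ _))
    incoming {suc i} i<k = trans
      (∑-𝟙-unique (λ x → suc x Fin.≟ clamp k (suc i)) d (Unique.allFin⁺ k) (∈-allFin (fromℕ< i<k)) hit
        (λ p → Fin.suc-injective (≡.trans p (≡.sym hit))))
      (at i<k)
      where
      hit : suc (fromℕ< i<k) ≡ clamp k (suc i)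
      hit = ≡.trans (≡.sym (clamp-suc (fromℕ< i<k))) (≡.cong (λ i → clamp k (suc i)) (Fin.toℕ-fromℕ< i<k))

  vertex : ℕ → ℕ → Vertex
  vertex k l = clamp m k , clamp n l

  -- The indicator of a vertex factors over the coordinates, so only the row and the column through
  -- that vertex survive, each contributing a path Laplacian.
  divergence-drop : ∀ φ {k l} → k ℕ.≤ m → l ℕ.≤ n →
    divergence (drop φ) (vertex k l) ≈
    φ (vertex k l) - φ (vertex (suc k) l) - (φ (vertex (ℕ.pred k) l) - φ (vertex k l)) +
    (φ (vertex k l) - φ (vertex k (suc l)) - (φ (vertex k (ℕ.pred l)) - φ (vertex k l)))
  divergence-drop φ {k} {l} k≤m l≤n = begin
    divergence (drop φ) x
      ≈⟨ ∑-++ (map inj₁ (cartesianProduct (allFin m) (allFin (suc n)))) _ _ ⟩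
    _ ≈⟨ +-cong (trans (reflexive (∑-map inj₁ (cartesianProduct (allFin m) (allFin (suc n))) _)) (∑-cartesianProduct (allFin m) (allFin (suc n)) _))
                (trans (reflexive (∑-map inj₂ (cartesianProduct (allFin (suc m)) (allFin n)) _)) (∑-cartesianProduct (allFin (suc m)) (allFin n) _)) ⟩
    (∑[ i ← allFin m ] ∑[ j ← allFin (suc n) ] drop φ (inj₁ (i , j)) * (𝟙 ((inject₁ i , j) ≟ᵥ x) - 𝟙 ((suc i , j) ≟ᵥ x))) +
    (∑[ i ← allFin (suc m) ] ∑[ j ← allFin n ] drop φ (inj₂ (i , j)) * (𝟙 ((i , inject₁ j) ≟ᵥ x) - 𝟙 ((i , suc j) ≟ᵥ x)))
      ≈⟨ +-cong (∑-cong (allFin m) horizontal) (trans (∑-comm (allFin (suc m)) (allFin n) _) (∑-cong (allFin n) vertical)) ⟩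
    (∑[ i ← allFin m ] drop φ (inj₁ (i , x₂)) * (𝟙 (inject₁ i Fin.≟ x₁) - 𝟙 (suc i Fin.≟ x₁))) +
    (∑[ j ← allFin n ] drop φ (inj₂ (x₁ , j)) * (𝟙 (inject₁ j Fin.≟ x₂) - 𝟙 (suc j Fin.≟ x₂)))
      ≈⟨ +-cong (second-difference m (λ i → φ (i , x₂)) k≤m) (second-difference n (λ j → φ (x₁ , j)) l≤n) ⟩
    _ ∎
    where
    open ≈-Reasoning
    x  = vertex k l
    x₁ = clamp m k
    x₂ = clamp n l

    𝟙-pair : ∀ i j → 𝟙 ((i , j) ≟ᵥ x) ≈ 𝟙 (i Fin.≟ x₁) * 𝟙 (j Fin.≟ x₂)
    𝟙-pair i j = 𝟙-∧ (i Fin.≟ x₁) (j Fin.≟ x₂) ((i , j) ≟ᵥ x)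
      (λ p → Product.,-injectiveˡ p , Product.,-injectiveʳ p) (≡.cong₂ _,_)

    horizontal : ∀ i →
      (∑[ j ← allFin (suc n) ] drop φ (inj₁ (i , j)) * (𝟙 ((inject₁ i , j) ≟ᵥ x) - 𝟙 ((suc i , j) ≟ᵥ x))) ≈
      drop φ (inj₁ (i , x₂)) * (𝟙 (inject₁ i Fin.≟ x₁) - 𝟙 (suc i Fin.≟ x₁))
    horizontal i = trans
      (∑-cong (allFin (suc n)) (λ j → trans (*-congˡ (+-cong (𝟙-pair (inject₁ i) j) (-‿cong (𝟙-pair (suc i) j))))
        (solve 4 (λ d a b c → d :* (a :* c :- b :* c) := c :* (d :* (a :- b))) refl
          (drop φ (inj₁ (i , j))) (𝟙 (inject₁ i Fin.≟ x₁)) (𝟙 (suc i Fin.≟ x₁)) (𝟙 (j Fin.≟ x₂)))))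
      (∑-𝟙-unique (Fin._≟ x₂) (λ j → drop φ (inj₁ (i , j)) * (𝟙 (inject₁ i Fin.≟ x₁) - 𝟙 (suc i Fin.≟ x₁)))
        (Unique.allFin⁺ (suc n)) (∈-allFin x₂) ≡.refl (λ p → p))

    vertical : ∀ j →
      (∑[ i ← allFin (suc m) ] drop φ (inj₂ (i , j)) * (𝟙 ((i , inject₁ j) ≟ᵥ x) - 𝟙 ((i , suc j) ≟ᵥ x))) ≈
      drop φ (inj₂ (x₁ , j)) * (𝟙 (inject₁ j Fin.≟ x₂) - 𝟙 (suc j Fin.≟ x₂))
    vertical j = trans
      (∑-cong (allFin (suc m)) (λ i → trans (*-congˡ (+-cong (𝟙-pair i (inject₁ j)) (-‿cong (𝟙-pair i (suc j)))))
        (solve 4 (λ d a b c → d :* (c :* a :- c :* b) := c :* (d :* (a :- b))) refl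
          (drop φ (inj₂ (i , j))) (𝟙 (inject₁ j Fin.≟ x₂)) (𝟙 (suc j Fin.≟ x₂)) (𝟙 (i Fin.≟ x₁)))))
      (∑-𝟙-unique (Fin._≟ x₁) (λ i → drop φ (inj₂ (i , j)) * (𝟙 (inject₁ j Fin.≟ x₂) - 𝟙 (suc j Fin.≟ x₂)))
        (Unique.allFin⁺ (suc m)) (∈-allFin x₁) ≡.refl (λ p → p))

  -- The source term is positive only at `s` and negative only at `t`, the two extreme corners,
  -- which gives the sign conditions of `Difference`. Horizontal edges use `Φ`, vertical edges its
  -- transpose.
  drop-positive : ∀ {c φ} → 1 ℕ.≤ m → 1 ℕ.≤ n → 0# < c →
                  (∀ x → divergence (drop φ) x ≈ c * (𝟙 (s ≟ᵥ x) - 𝟙 (t ≟ᵥ x))) → ∀ e → 0# < drop φ e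
  drop-positive {c} {φ} 1≤m 1≤n 0<c div = positive
    where
    Φ Φᵀ σ : ℕ → ℕ → Carrier
    -- The shift by one turns index `0` into a copy of index `1`, since `ℕ.pred 0` is `0`.
    Φ  i j = φ (vertex (ℕ.pred i) (ℕ.pred j))
    Φᵀ j i = Φ i j
    σ  k l = c * (𝟙 (s ≟ᵥ vertex k l) - 𝟙 (t ≟ᵥ vertex k l))

    toℕ-clamp-≤ : ∀ {k i} → i ℕ.≤ k → toℕ (clamp k i) ≡ i
    toℕ-clamp-≤ {k} {i} i≤k = ≡.trans (toℕ-clamp k i) (ℕ.m≤n⇒m⊓n≡m i≤k)

    clamp≢top : ∀ {k i} → i ℕ.< k → fromℕ k ≢ clamp k i
    clamp≢top {k} {i} i<k p = ℕ.<-irrefl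
      (≡.trans (≡.sym (toℕ-clamp-≤ (ℕ.<⇒≤ i<k))) (≡.trans (≡.cong toℕ (≡.sym p)) (Fin.toℕ-fromℕ k))) i<k

    clamp≢zero : ∀ {k i} → i ℕ.< k → zero ≢ clamp k (suc i)
    clamp≢zero i<k p = ℕ.0≢1+n (≡.trans (≡.cong toℕ p) (toℕ-clamp-≤ i<k))

    σ-nonneg : ∀ {k l} → t ≢ vertex k l → 0# ≤ σ k l
    σ-nonneg {k} {l} t≢ = *-nonneg (<⇒≤ 0<c) (≤-respʳ-≈
      (sym (trans (+-congˡ (-‿cong (𝟙-no (t ≟ᵥ vertex k l) t≢))) (solve 1 (λ x → x :- con (+ 0) := x) refl _)))
      (𝟙-nonneg (s ≟ᵥ vertex k l)))

    σ-nonpos : ∀ {k l} → s ≢ vertex k l → σ k l ≤ 0#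
    σ-nonpos {k} {l} s≢ = 0≤y-x⇒x≤y (≤-respʳ-≈
      (begin
        c * 𝟙 (t ≟ᵥ vertex k l)                    ≈⟨ solve 2 (λ c j → c :* j := con (+ 0) :- c :* (con (+ 0) :- j)) refl c (𝟙 (t ≟ᵥ vertex k l)) ⟩
        0# - c * (0# - 𝟙 (t ≟ᵥ vertex k l))        ≈⟨ +-congˡ (-‿cong (*-congˡ (+-congʳ (𝟙-no (s ≟ᵥ vertex k l) s≢)))) ⟨
        0# - σ k l                                  ∎)
      (*-nonneg (<⇒≤ 0<c) (𝟙-nonneg (t ≟ᵥ vertex k l))))
      where open ≈-Reasoning

    σ-corner : 0# < σ 0 0
    σ-corner = <-respʳ-≈ (begin
      c                                                       ≈⟨ solve 1 (λ c → c := c :* (con (+ 1) :- con (+ 0))) refl c ⟩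
      c * (1# - 0#)                                           ≈⟨ *-congˡ (+-cong (𝟙-yes (s ≟ᵥ vertex 0 0) ≡.refl)
                                                                   (-‿cong (𝟙-no (t ≟ᵥ vertex 0 0) (λ p → clamp≢top 1≤m (Product.,-injectiveˡ p))))) ⟨
      σ 0 0                                                   ∎) 0<c
      where open ≈-Reasoning

    five-point : ∀ {k l} → k ℕ.≤ m → l ℕ.≤ n →
      Φ (suc k) (suc l) - Φ (suc (suc k)) (suc l) - (Φ k (suc l) - Φ (suc k) (suc l)) +
      (Φ (suc k) (suc l) - Φ (suc k) (suc (suc l)) - (Φ (suc k) l - Φ (suc k) (suc l))) ≈ σ k l
    five-point k≤m l≤n = trans (sym (divergence-drop φ k≤m l≤n)) (div _)

    beyondˡ : ∀ j → Φ (suc m) j ≈ Φ (suc (suc m)) j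
    beyondˡ j = reflexive (≡.cong (λ x → φ (x , clamp n (ℕ.pred j))) (≡.sym (clamp-beyond m)))

    beyondʳ : ∀ i → Φ i (suc (suc n)) ≈ Φ i (suc n)
    beyondʳ i = reflexive (≡.cong (λ y → φ (clamp m (ℕ.pred i) , y)) (clamp-beyond n))

    module Rows = Difference Φ σ m n (λ _ → refl) beyondˡ (λ _ → refl) beyondʳ five-point σ-corner
      (λ k<m _ → σ-nonneg (λ p → clamp≢top k<m (Product.,-injectiveˡ p)))
      (λ k<m _ → σ-nonpos (λ p → clamp≢zero k<m (Product.,-injectiveˡ p)))

    module Cols = Difference Φᵀ (λ l k → σ k l) n m (λ _ → refl) (λ i → sym (beyondʳ i)) (λ _ → refl) (λ j → sym (beyondˡ j))
      (λ l≤n k≤m → trans (+-comm _ _) (five-point k≤m l≤n)) σ-corner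
      (λ l<n _ → σ-nonneg (λ p → clamp≢top l<n (Product.,-injectiveʳ p)))
      (λ l<n _ → σ-nonpos (λ p → clamp≢zero l<n (Product.,-injectiveʳ p)))

    positive : ∀ e → 0# < drop φ e
    positive (inj₁ (i , j)) = ≡.subst (0# <_)
      (≡.cong₂ (λ x y → φ x - φ y) (≡.cong₂ _,_ (clamp-inject₁ i) (clamp-toℕ j)) (≡.cong₂ _,_ (clamp-suc i) (clamp-toℕ j)))
      (Rows.h-positive (Fin.toℕ<n i) (Fin.toℕ≤pred[n] j))
    positive (inj₂ (i , j)) = ≡.subst (0# <_)
      (≡.cong₂ (λ x y → φ x - φ y) (≡.cong₂ _,_ (clamp-toℕ i) (clamp-inject₁ j)) (≡.cong₂ _,_ (clamp-toℕ i) (clamp-suc j)))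
      (Cols.h-positive (Fin.toℕ<n j) (Fin.toℕ≤pred[n] i))

-- Old and new equilibria of the grid.

module Braess (ℝ : Reals) (m n : ℕ) (1≤m : 1 ℕ.≤ m) (1≤n : 1 ℕ.≤ n)
              (a q : Reals.Carrier ℝ) (0<a : Reals._<_ ℝ (Reals.0# ℝ) a) (0<q : Reals._<_ ℝ (Reals.0# ℝ) q)
              (L⁺ : Grid.Vertex m n → Grid.Vertex m n → Reals.Carrier ℝ)
              (mp : Flow.IsMoorePenroseInverse ℝ m n (Flow.laplacian ℝ m n a) L⁺) where
  open Reals ℝ hiding (zero)
  open Flow ℝ
  open Grid m n
  open GridGraph m n
  open IntegerRingSolver ℝ
  open OrderedField ℝ
  open Sums ℝ
  open Networks ℝ
  open Laplacian ℝ m n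
  open Pseudoinverse ℝ m n
  open ElectricFlow ℝ m n

  s≢t : s ≢ t
  s≢t s≡t = ℕ.<⇒≢ 1≤m (≡.trans (≡.cong toℕ (Product.,-injectiveˡ s≡t)) (Fin.toℕ-fromℕ m))

  -- The level used as a potential. Its drop is `- 1#` on every grid edge, so it represents the
  -- constant part `b` of the latency and measures the total edge flow.
  height : Vertex → Carrier
  height x = fromNat (level x)

  drop-height : ∀ e → drop height e ≈ - 1#
  drop-height e = trans (+-congˡ (-‿cong (reflexive (≡.cong fromNat (level-step e)))))
    (solve 1 (λ x → x :- (con (+ 1) :+ x) := :- con (+ 1)) refl (height (gridTail e)))

  a*[x/a]≈x : ∀ x → a * (x / a) ≈ x
  a*[x/a]≈x = x*[y/x]≈y 0<a

  ⟨_,_⟩ : (f g : GridEdge → Carrier) → Carrier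
  ⟨ f , g ⟩ = ∑[ e ← gridEdges ] f e * g e

  ⟨⟩-affine : ∀ f g b → ⟨ f , (λ e → a * g e + b) ⟩ ≈ a * ⟨ f , g ⟩ + b * ∑ gridEdges f
  ⟨⟩-affine f g b = begin
    (∑[ e ← gridEdges ] f e * (a * g e + b))
      ≈⟨ ∑-cong gridEdges (λ e → solve 4 (λ f a g b → f :* (a :* g :+ b) := a :* (f :* g) :+ b :* f) refl (f e) a (g e) b) ⟩
    (∑[ e ← gridEdges ] (a * (f e * g e) + b * f e))
      ≈⟨ ∑-+ gridEdges _ _ ⟩
    (∑[ e ← gridEdges ] a * (f e * g e)) + (∑[ e ← gridEdges ] b * f e)
      ≈⟨ +-cong (*-distribˡ-∑ gridEdges a _) (*-distribˡ-∑ gridEdges b f) ⟨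
    a * ⟨ f , g ⟩ + b * ∑ gridEdges f ∎
    where open ≈-Reasoning

  ⟨⟩-square : ∀ f g → (∑[ e ← gridEdges ] (f e - g e) * (f e - g e)) ≈ ⟨ f , f ⟩ - (⟨ f , g ⟩ + ⟨ f , g ⟩) + ⟨ g , g ⟩
  ⟨⟩-square f g = begin
    (∑[ e ← gridEdges ] (f e - g e) * (f e - g e))
      ≈⟨ ∑-cong gridEdges (λ e → solve 2 (λ f g → (f :- g) :* (f :- g) := f :* f :- (f :* g :+ f :* g) :+ g :* g) refl (f e) (g e)) ⟩
    (∑[ e ← gridEdges ] (f e * f e - (f e * g e + f e * g e) + g e * g e))
      ≈⟨ trans (∑-+ gridEdges _ _) (+-congʳ (trans (∑-minus gridEdges _ _) (+-congˡ (-‿cong (∑-+ gridEdges _ _))))) ⟩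
    ⟨ f , f ⟩ - (⟨ f , g ⟩ + ⟨ f , g ⟩) + ⟨ g , g ⟩ ∎
    where open ≈-Reasoning

  ⟨⟩-height : ∀ f → ⟨ f , drop height ⟩ ≈ - ∑ gridEdges f
  ⟨⟩-height f = begin
    ⟨ f , drop height ⟩                   ≈⟨ ∑-cong gridEdges (λ e → trans (*-congˡ (drop-height e)) (*-comm (f e) _)) ⟩
    (∑[ e ← gridEdges ] - 1# * f e)       ≈⟨ *-distribˡ-∑ gridEdges (- 1#) f ⟨
    - 1# * ∑ gridEdges f                  ≈⟨ solve 1 (λ x → :- con (+ 1) :* x := :- x) refl (∑ gridEdges f) ⟩
    - ∑ gridEdges f                       ∎
    where open ≈-Reasoning

  -- Works from the divergence alone and so covers the current `f₁`, whose sign may vary from edge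
  -- to edge.
  pair-divergence : ∀ {f c p r} (π : Vertex → Carrier) → (∀ x → divergence f x ≈ c * (𝟙 (p ≟ᵥ x) - 𝟙 (r ≟ᵥ x))) →
                    ⟨ f , drop π ⟩ ≈ c * (π p - π r)
  pair-divergence {f} {c} {p} {r} π div = begin
    ⟨ f , drop π ⟩
      ≈⟨ green π f ⟨
    (∑[ x ← vertices ] π x * divergence f x)
      ≈⟨ ∑-cong vertices (λ x → trans (*-congˡ (div x))
           (solve 4 (λ π c i j → π :* (c :* (i :- j)) := i :* (c :* π) :- j :* (c :* π)) refl (π x) c (𝟙 (p ≟ᵥ x)) (𝟙 (r ≟ᵥ x)))) ⟩
    (∑[ x ← vertices ] (𝟙 (p ≟ᵥ x) * (c * π x) - 𝟙 (r ≟ᵥ x) * (c * π x)))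
      ≈⟨ trans (∑-minus vertices _ _) (+-cong (∑-sift p (λ x → c * π x)) (-‿cong (∑-sift r (λ x → c * π x)))) ⟩
    c * π p - c * π r
      ≈⟨ solve 3 (λ c p r → c :* p :- c :* r := c :* (p :- r)) refl c (π p) (π r) ⟩
    c * (π p - π r) ∎
    where open ≈-Reasoning

  φ : Vertex → Carrier
  φ x = q * dipole 0<a mp s t x

  f₀ : GridEdge → Carrier
  f₀ = gradient a φ

  a*f₀≈drop : ∀ e → a * f₀ e ≈ drop φ e
  a*f₀≈drop e = a*[x/a]≈x (drop φ e)

  divergence-scale : ∀ c f x → divergence (λ e → c * f e) x ≈ c * divergence f x
  divergence-scale c f x = trans (∑-cong gridEdges (λ e → *-assoc c (f e) _)) (sym (*-distribˡ-∑ gridEdges c _))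

  divergence-f₀ : ∀ x → divergence f₀ x ≈ q * (𝟙 (s ≟ᵥ x) - 𝟙 (t ≟ᵥ x))
  divergence-f₀ x = begin
    divergence f₀ x
      ≈⟨ ∑-cong gridEdges (λ e → *-congʳ (solve 4 (λ q x y r → (q :* x :- q :* y) :* r := q :* ((x :- y) :* r)) refl q _ _ (a ⁻¹))) ⟩
    divergence (λ e → q * gradient a (dipole 0<a mp s t) e) x
      ≈⟨ divergence-scale q _ x ⟩
    q * divergence (gradient a (dipole 0<a mp s t)) x
      ≈⟨ *-congˡ (divergence-dipole 0<a mp s t x) ⟩
    q * (𝟙 (s ≟ᵥ x) - 𝟙 (t ≟ᵥ x)) ∎
    where open ≈-Reasoning

  f₀-positive : ∀ e → 0# < f₀ e
  f₀-positive e = *-pos (drop-positive {φ = φ} 1≤m 1≤n (*-pos 0<a 0<q) div e) (0<x⇒0<x⁻¹ 0<a)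
    where
    div : ∀ x → divergence (drop φ) x ≈ a * q * (𝟙 (s ≟ᵥ x) - 𝟙 (t ≟ᵥ x))
    div x = begin
      divergence (drop φ) x               ≈⟨ ∑-cong gridEdges (λ e → *-congʳ (a*f₀≈drop e)) ⟨
      divergence (λ e → a * f₀ e) x       ≈⟨ divergence-scale a f₀ x ⟩
      a * divergence f₀ x                 ≈⟨ *-congˡ (divergence-f₀ x) ⟩
      a * (q * (𝟙 (s ≟ᵥ x) - 𝟙 (t ≟ᵥ x))) ≈⟨ *-assoc a q _ ⟨
      a * q * (𝟙 (s ≟ᵥ x) - 𝟙 (t ≟ᵥ x))   ∎
      where open ≈-Reasoning

  module OldNetwork (b : Carrier) where
    open Equilibrium (gridNetwork m n a b) q public
    open PathFlows (gridNetwork m n a b) gridEdges-unique gridEdges-complete s≢t q public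
    open Acyclic level level-< (λ _ → z≤n) level-≤-t public using (decompose)

    f₀-feasible : IsFeasible f₀
    f₀-feasible = isFeasible (λ e → <⇒≤ (f₀-positive e)) divergence-f₀

    f₀-decomposition : ∃[ D ] IsDecomposition D f₀
    f₀-decomposition = decompose f₀-feasible

    -- Subtracting `b * height` adds `b` to the drop of `φ` on each edge, which yields exactly the
    -- latency at `f₀`.
    π₀ : Vertex → Carrier
    π₀ x = φ x - b * height x

    f₀-equilibrium : IsUserEquilibrium f₀ × cost f₀ ≈ q * (π₀ s - π₀ t)
    f₀-equilibrium = potential-equilibrium π₀ f₀-feasible (proj₂ f₀-decomposition) λ e → begin
      a * f₀ e + b                               ≈⟨ +-congʳ (a*f₀≈drop e) ⟩
      drop φ e + b                               ≈⟨ solve 2 (λ d b → d :+ b := d :- b :* (:- con (+ 1))) refl (drop φ e) b ⟩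
      drop φ e - b * - 1#                        ≈⟨ +-congˡ (-‿cong (*-congˡ (drop-height e))) ⟨
      drop φ e - b * drop height e               ≈⟨ solve 5 (λ p r b h k → p :- r :- b :* (h :- k) := p :- b :* h :- (r :- b :* k)) refl
                                                      (φ (gridTail e)) (φ (gridHead e)) b (height (gridTail e)) (height (gridHead e)) ⟩
      π₀ (gridTail e) - π₀ (gridHead e)          ∎
      where open ≈-Reasoning

    -- All paths have the same number of edges, so this total is common to all feasible flows and
    -- `b` drops out when old flows are compared.
    total-flow : ∀ {f D} → IsFeasible f → IsDecomposition D f → ∑ gridEdges f ≈ - (q * (height s - height t))
    total-flow {f} {D} feas dec = begin
      ∑ gridEdges f                  ≈⟨ solve 1 (λ x → x := :- (:- x)) refl (∑ gridEdges f) ⟩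
      - - ∑ gridEdges f              ≈⟨ -‿cong (trans (sym (⟨⟩-height f)) (flow-potential {D} feas dec height)) ⟩
      - (q * (height s - height t))  ∎
      where open ≈-Reasoning

    -- `a * f₀` is a gradient, so its pairing depends only on the value `q`; in particular `f - f₀`
    -- is orthogonal to `f₀`.
    ⟨⟩-f₀ : ∀ {f D} → IsFeasible f → IsDecomposition D f → a * ⟨ f , f₀ ⟩ ≈ q * (φ s - φ t)
    ⟨⟩-f₀ {f} {D} feas dec = begin
      a * ⟨ f , f₀ ⟩                             ≈⟨ *-distribˡ-∑ gridEdges a _ ⟩
      (∑[ e ← gridEdges ] a * (f e * f₀ e))      ≈⟨ ∑-cong gridEdges (λ e → trans
          (solve 3 (λ a f g → a :* (f :* g) := f :* (a :* g)) refl a (f e) (f₀ e)) (*-congˡ (a*f₀≈drop e))) ⟩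
      ⟨ f , drop φ ⟩                             ≈⟨ flow-potential {D} feas dec φ ⟩
      q * (φ s - φ t)                            ∎
      where open ≈-Reasoning

    cost-expand : ∀ f → cost f ≈ a * ⟨ f , f ⟩ + b * ∑ gridEdges f
    cost-expand f = ⟨⟩-affine f f b

    -- `IsBraessRatio` supplies an arbitrary old equilibrium, which is here identified with `f₀`.
    -- Its optimality against `f₀` reads `a⟨f, f⟩ ≤ a⟨f₀, f⟩`; by orthogonality the difference of
    -- the two sides is `a` times the squared distance.
    equilibrium-unique : ∀ {f} → IsUserEquilibrium f → ∀ e → f e ≈ f₀ e
    equilibrium-unique {f} ue@(feas , D , dec , _) e = begin
      f e                  ≈⟨ solve 2 (λ f g → f := f :- g :+ g) refl (f e) (f₀ e) ⟩
      f e - f₀ e + f₀ e    ≈⟨ +-congʳ (∑-squares≤0 {xs = gridEdges} squares≤0 (gridEdges-complete e)) ⟩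
      0# + f₀ e            ≈⟨ +-identityˡ _ ⟩
      f₀ e                 ∎
      where
      open ≈-Reasoning
      D₀   = proj₁ f₀-decomposition
      dec₀ = proj₂ f₀-decomposition
      S    = ∑ gridEdges f

      optimal : a * ⟨ f , f ⟩ ≤ a * ⟨ f₀ , f ⟩
      optimal = 0≤y-x⇒x≤y (≤-respʳ-≈
        (trans (+-cong (trans (⟨⟩-affine f₀ f b) (+-congˡ (*-congˡ (trans (total-flow {f₀} {D₀} f₀-feasible dec₀) (sym (total-flow {f} {D} feas dec))))))
                       (-‿cong (cost-expand f)))
               (solve 3 (λ x y z → x :+ z :- (y :+ z) := x :- y) refl (a * ⟨ f₀ , f ⟩) (a * ⟨ f , f ⟩) (b * S)))
        (x≤y⇒0≤y-x (equilibrium-optimal {f} {f₀} {D₀} 0<q ue f₀-feasible dec₀)))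

      ⟨⟩-comm : a * ⟨ f₀ , f ⟩ ≈ a * ⟨ f , f₀ ⟩
      ⟨⟩-comm = *-congˡ (∑-cong gridEdges (λ e → *-comm _ _))

      orthogonal : a * ⟨ f₀ , f₀ ⟩ ≈ a * ⟨ f , f₀ ⟩
      orthogonal = trans (⟨⟩-f₀ {f₀} {D₀} f₀-feasible dec₀) (sym (⟨⟩-f₀ {f} {D} feas dec))

      squares≤0 : (∑[ e ← gridEdges ] (f e - f₀ e) * (f e - f₀ e)) ≤ 0#
      squares≤0 = ≮⇒≥ λ pos → <-irrefl refl (<-≤-trans (*-pos 0<a pos) (≤-respˡ-≈
        (begin
          a * ⟨ f , f ⟩ - a * ⟨ f₀ , f ⟩
            ≈⟨ solve 2 (λ x y → x :- y := x :- (y :+ y) :+ y) refl (a * ⟨ f , f ⟩) (a * ⟨ f₀ , f ⟩) ⟩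
          a * ⟨ f , f ⟩ - (a * ⟨ f₀ , f ⟩ + a * ⟨ f₀ , f ⟩) + a * ⟨ f₀ , f ⟩
            ≈⟨ +-cong (+-congˡ (-‿cong (+-cong ⟨⟩-comm ⟨⟩-comm))) (trans ⟨⟩-comm (sym orthogonal)) ⟩
          a * ⟨ f , f ⟩ - (a * ⟨ f , f₀ ⟩ + a * ⟨ f , f₀ ⟩) + a * ⟨ f₀ , f₀ ⟩
            ≈⟨ solve 4 (λ a x y z → a :* x :- (a :* y :+ a :* y) :+ a :* z := a :* (x :- (y :+ y) :+ z)) refl a ⟨ f , f ⟩ ⟨ f , f₀ ⟩ ⟨ f₀ , f₀ ⟩ ⟩
          a * (⟨ f , f ⟩ - (⟨ f , f₀ ⟩ + ⟨ f , f₀ ⟩) + ⟨ f₀ , f₀ ⟩)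
            ≈⟨ *-congˡ (⟨⟩-square f f₀) ⟨
          a * (∑[ e ← gridEdges ] (f e - f₀ e) * (f e - f₀ e)) ∎)
        (≤-respʳ-≈ (-‿inverseʳ _) (+-monoˡ-≤ (- (a * ⟨ f₀ , f ⟩)) optimal))))

    cost-positive : 0# ≤ b → ∀ {f} → (∀ e → 0# < f e) → 0# < cost f
    cost-positive 0≤b {f} 0<f = <-≤-trans (term-pos edge)
      (∑-∈-≤ (λ e → <⇒≤ (term-pos e)) (gridEdges-complete edge))
      where
      term-pos : ∀ e → 0# < f e * (a * f e + b)
      term-pos e = *-pos (0<f e) (+-pos-nonneg (*-pos 0<a (0<f e)) 0≤b)
      edge : GridEdge
      edge = inj₁ (fromℕ< 1≤m , zero)

  module Chord (u v : Vertex) where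

    ψ : Vertex → Carrier
    ψ = dipole 0<a mp u v

    V : Carrier
    V = voltage m n L⁺ q u v

    V≈ψ : V ≈ q * (ψ s - ψ t)
    V≈ψ = voltage-dipole 0<a mp q u v

    f₁ : GridEdge → Carrier
    f₁ = gradient a ψ

    divergence-f₁ : ∀ x → divergence f₁ x ≈ 1# * (𝟙 (u ≟ᵥ x) - 𝟙 (v ≟ᵥ x))
    divergence-f₁ x = trans (divergence-dipole 0<a mp u v x) (sym (*-identityˡ _))

    -- Reciprocity: the pairing of the currents `f₀` and `f₁` is evaluated once by the potential `φ`
    -- and once by `ψ`.
    V≈φ : φ u - φ v ≈ V
    V≈φ = begin
      φ u - φ v                                      ≈⟨ *-identityˡ _ ⟨
      1# * (φ u - φ v)                               ≈⟨ pair-divergence φ divergence-f₁ ⟨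
      ⟨ f₁ , drop φ ⟩                                ≈⟨ ∑-cong gridEdges (λ e → solve 3 (λ x r y → x :* r :* y := y :* r :* x) refl (drop ψ e) (a ⁻¹) (drop φ e)) ⟩
      ⟨ f₀ , drop ψ ⟩                                ≈⟨ pair-divergence ψ divergence-f₀ ⟩
      q * (ψ s - ψ t)                                ≈⟨ V≈ψ ⟨
      V                                              ∎
      where open ≈-Reasoning

    gain : Carrier
    gain = height v - height u

    module NewNetwork (b c d : Carrier) where
      N = chordNetwork m n a b c d u v
      open Network N using (edges)

      edges-unique : Unique edges
      edges-unique = All.map⁺ (All.universal (λ _ ()) gridEdges) ∷ Unique.map⁺ Maybe.just-injective gridEdges-unique

      edges-complete : ∀ e → e ∈ edges
      edges-complete nothing  = here ≡.refl
      edges-complete (just e) = there (∈-map⁺ just (gridEdges-complete e))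

      open Equilibrium N q public
      open PathFlows N edges-unique edges-complete s≢t q public

      ∑-edges : ∀ (F : Maybe GridEdge → Carrier) → ∑ edges F ≈ F nothing + ∑ gridEdges (λ e → F (just e))
      ∑-edges F = +-congˡ (reflexive (∑-map just gridEdges F))

    -- Necessity of negative voltage and positive level gain.

    module Forward {b c d : Carrier} (0≤b : 0# ≤ b) (0≤c : 0# ≤ c) (0≤d : 0# ≤ d) where
      module Old = OldNetwork b
      module New = NewNetwork b c d

      lift-walk : ∀ {x y} es → Old.IsWalk x es y → New.IsWalk x (map just es) y
      lift-walk []       w         = w
      lift-walk (e ∷ es) (t≡x , w) = t≡x , lift-walk es w

      lift : Old.Path → New.Path
      lift P = record
        { route  = map just (Old.route P)
        ; isWalk = lift-walk (Old.route P) (Old.Path.isWalk P)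
        ; simple = ≡.subst (λ xs → Unique (s ∷ xs)) (List.map-∘ (Old.route P)) (Old.Path.simple P)
        }

      module _ {f : GridEdge → Carrier} {g : Maybe GridEdge → Carrier}
               (old : Old.IsUserEquilibrium f) (new : New.IsUserEquilibrium g)
               (worse : Old.cost f < New.cost g) where

        private
          D  = proj₁ (proj₂ old)
          dec = proj₁ (proj₂ (proj₂ old))
          D′ = proj₁ (proj₂ new)
          dec′ = proj₁ (proj₂ (proj₂ new))

          y : Carrier
          y = g nothing

          g₀ : GridEdge → Carrier
          g₀ e = g (just e)

          0≤y : 0# ≤ y
          0≤y = New.IsFeasible.nonnegative (proj₁ new) nothing

          -- The old paths survive in the new network, so the old flow competes at the new latencies
          -- without using the chord.
          optimal : New.cost g ≤ ⟨ f , (λ e → a * g₀ e + b) ⟩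
          optimal =
            let (c′ , cost≤ , c′≤) = New.latency-level {g} 0<q new in begin
            New.cost g          ≤⟨ cost≤ ⟩
            q * c′              ≈⟨ *-congʳ (Old.amount≈q {D} {f} (proj₁ old) dec) ⟨
            Old.amount D * c′   ≤⟨ Old.amount-≤ {D} {λ P → New.pathLatency g (lift P)} (Old.IsDecomposition.nonnegative dec) (λ P → c′≤ (lift P)) ⟩
            (∑[ Ph ← D ] proj₂ Ph * New.pathLatency g (lift (proj₁ Ph)))
                                ≈⟨ ∑-cong D (λ (P , h) → *-congˡ (reflexive (∑-map just (Old.route P) _))) ⟩
            (∑[ Ph ← D ] proj₂ Ph * (∑[ e ← Old.route (proj₁ Ph) ] (a * g₀ e + b)))
                                ≈⟨ Old.pairing D (Old.IsDecomposition.sumsTo dec) (λ e → a * g₀ e + b) ⟨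
            ⟨ f , (λ e → a * g₀ e + b) ⟩ ∎
            where open ≤-Reasoning

          new-potential : ∀ π → y * (π u - π v) + ⟨ g₀ , drop π ⟩ ≈ q * (π s - π t)
          new-potential π = trans (sym (New.∑-edges _)) (New.flow-potential {D′} {g} (proj₁ new) dec′ π)

          new-cost : New.cost g ≈ y * (c * y + d) + (a * ⟨ g₀ , g₀ ⟩ + b * ∑ gridEdges g₀)
          new-cost = trans (New.∑-edges _) (+-congˡ (⟨⟩-affine g₀ g₀ b))

          total : ∑ gridEdges f ≈ ∑ gridEdges g₀ + y * gain
          total = begin
            ∑ gridEdges f                                 ≈⟨ Old.total-flow {f} {D} (proj₁ old) dec ⟩
            - (q * (height s - height t))                 ≈⟨ -‿cong (new-potential height) ⟨
            - (y * (height u - height v) + ⟨ g₀ , drop height ⟩) ≈⟨ -‿cong (+-congˡ (⟨⟩-height g₀)) ⟩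
            - (y * (height u - height v) - ∑ gridEdges g₀)
              ≈⟨ solve 4 (λ y hu hv S → :- (y :* (hu :- hv) :- S) := S :+ y :* (hv :- hu)) refl y (height u) (height v) (∑ gridEdges g₀) ⟩
            ∑ gridEdges g₀ + y * gain                     ∎
            where open ≈-Reasoning

          a*⟨,f⟩ : ∀ h → a * ⟨ h , f ⟩ ≈ ⟨ h , drop φ ⟩
          a*⟨,f⟩ h = trans (*-distribˡ-∑ gridEdges a _) (∑-cong gridEdges (λ e → trans
            (solve 3 (λ a f g → a :* (f :* g) := f :* (a :* g)) refl a (h e) (f e))
            (*-congˡ (trans (*-congˡ (Old.equilibrium-unique {f} old e)) (a*f₀≈drop e)))))

          energy : a * ⟨ f , f ⟩ ≈ y * V + a * ⟨ f , g₀ ⟩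
          energy = begin
            a * ⟨ f , f ⟩                        ≈⟨ a*⟨,f⟩ f ⟩
            ⟨ f , drop φ ⟩                       ≈⟨ Old.flow-potential {D} {f} (proj₁ old) dec φ ⟩
            q * (φ s - φ t)                      ≈⟨ new-potential φ ⟨
            y * (φ u - φ v) + ⟨ g₀ , drop φ ⟩    ≈⟨ +-cong (*-congˡ V≈φ) (sym (a*⟨,f⟩ g₀)) ⟩
            y * V + a * ⟨ g₀ , f ⟩               ≈⟨ +-congˡ (*-congˡ (∑-cong gridEdges (λ e → *-comm _ _))) ⟩
            y * V + a * ⟨ f , g₀ ⟩               ∎
            where open ≈-Reasoning

          -yV-positive : 0# < - (y * V)
          -yV-positive = <-respʳ-≈
            (begin
              ⟨ f , (λ e → a * g₀ e + b) ⟩ - Old.cost f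
                ≈⟨ +-cong (⟨⟩-affine f g₀ b) (-‿cong (trans (Old.cost-expand f) (+-congʳ energy))) ⟩
              a * ⟨ f , g₀ ⟩ + b * ∑ gridEdges f - (y * V + a * ⟨ f , g₀ ⟩ + b * ∑ gridEdges f)
                ≈⟨ solve 3 (λ x z w → x :+ z :- (w :+ x :+ z) := :- w) refl (a * ⟨ f , g₀ ⟩) (b * ∑ gridEdges f) (y * V) ⟩
              - (y * V) ∎)
            (x<y⇒0<y-x (<-≤-trans worse optimal))
            where open ≈-Reasoning

        voltage-negative : V < 0#
        voltage-negative with V <? 0#
        ... | yes V<0 = V<0
        ... | no  V≮0 = contradiction (0<-x⇒x<0 -yV-positive) (≤⇒≯ (*-nonneg 0≤y (≮⇒≥ V≮0)))

        -- b·y·gain exceeds −yV by the slack in optimality plus the chord latency y(cy + d) plus a‖f − g‖².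
        gain-positive : 0# < gain
        gain-positive = *-cancelˡ-< (*-nonneg 0≤b 0≤y) (<-respˡ-≈ (sym (zeroʳ _)) (<-respʳ-≈
          (begin
            - (y * V) + ((⟨ f , (λ e → a * g₀ e + b) ⟩ - New.cost g) + y * (c * y + d) + a * (∑[ e ← gridEdges ] (f e - g₀ e) * (f e - g₀ e)))
              ≈⟨ +-congˡ (+-cong (+-congʳ (+-cong (trans (⟨⟩-affine f g₀ b) (+-congˡ (*-congˡ total))) (-‿cong new-cost)))
                                 (trans (*-congˡ (⟨⟩-square f g₀))
                                   (trans (solve 4 (λ a x y z → a :* (x :- (y :+ y) :+ z) := a :* x :- (a :* y :+ a :* y) :+ a :* z) refl a ⟨ f , f ⟩ ⟨ f , g₀ ⟩ ⟨ g₀ , g₀ ⟩)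
                                     (+-congʳ (+-congʳ energy))))) ⟩
            - (y * V) + ((a * ⟨ f , g₀ ⟩ + b * (∑ gridEdges g₀ + y * gain) - (y * (c * y + d) + (a * ⟨ g₀ , g₀ ⟩ + b * ∑ gridEdges g₀))) + y * (c * y + d)
              + (y * V + a * ⟨ f , g₀ ⟩ - (a * ⟨ f , g₀ ⟩ + a * ⟨ f , g₀ ⟩) + a * ⟨ g₀ , g₀ ⟩))
              ≈⟨ solve 8 (λ w fg b S y k l gg → :- w :+ ((fg :+ b :* (S :+ y :* k) :- (l :+ (gg :+ b :* S))) :+ l :+ (w :+ fg :- (fg :+ fg) :+ gg)) := b :* y :* k) refl
                   (y * V) (a * ⟨ f , g₀ ⟩) b (∑ gridEdges g₀) y gain (y * (c * y + d)) (a * ⟨ g₀ , g₀ ⟩) ⟩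
            b * y * gain ∎)
          (+-pos-nonneg -yV-positive (+-nonneg (+-nonneg (x≤y⇒0≤y-x optimal)
            (*-nonneg 0≤y (+-nonneg (*-nonneg 0≤c 0≤y) 0≤d)))
            (*-nonneg (<⇒≤ 0<a) (∑-nonneg gridEdges (λ e → square-nonneg (f e - g₀ e))))))))
          where open ≈-Reasoning

    capable⇒ : BraessCapable m n a q u v → V < 0# × 0ℤ ℤ.< levelGain u v
    capable⇒ (b , c , d , 0≤b , 0≤c , 0≤d , r , (f , g , old , new , r≈) , 1<r) =
      voltage-negative {f} {g} old new worse , levelGain-positive
      where
      open Forward 0≤b 0≤c 0≤d

      0<cost : 0# < Old.cost f
      0<cost = Old.cost-positive 0≤b {f} (λ e → <-respʳ-≈ (sym (Old.equilibrium-unique {f} old e)) (f₀-positive e))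

      worse : Old.cost f < New.cost g
      worse = begin-strict
        Old.cost f                          ≈⟨ *-identityʳ _ ⟨
        Old.cost f * 1#                     <⟨ 0<y-x⇒x<y (<-respʳ-≈ (solve 3 (λ c x y → c :* (y :- x) := c :* y :- c :* x) refl (Old.cost f) 1# r)
                                                 (*-pos 0<cost (x<y⇒0<y-x 1<r))) ⟩
        Old.cost f * r                      ≈⟨ *-congˡ r≈ ⟩
        Old.cost f * (New.cost g / Old.cost f) ≈⟨ x*[y/x]≈y 0<cost (New.cost g) ⟩
        New.cost g                          ∎
        where open ≤-Reasoning

      level-<ᵘᵛ : level u ℕ.< level v
      level-<ᵘᵛ = ℕ.≰⇒> λ v≤u → ≤⇒≯ (fromNat-mono-≤ v≤u)
        (0<y-x⇒x<y (gain-positive {f} {g} old new worse))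

      levelGain-positive : 0ℤ ℤ.< levelGain u v
      levelGain-positive = ≡.subst (ℤ._< levelGain u v) (ℤ.n⊖n≡0 (level u)) (ℤ.⊖-monoˡ-< (level u) level-<ᵘᵛ)

    -- Sufficiency: a chord of latency zero that raises the cost.

    module Backward (V<0 : V < 0#) (level-<ᵘᵛ : level u ℕ.< level v) where

      0<gain : 0# < gain
      0<gain = x<y⇒0<y-x (fromNat-mono-< level-<ᵘᵛ)

      scale = scale-below gridEdges f₀ f₁ f₀-positive

      ε : Carrier
      ε = proj₁ scale

      0<ε : 0# < ε
      0<ε = proj₁ (proj₂ scale)

      -- The effective resistance between `u` and `v`.
      R : Carrier
      R = ψ u - ψ v

      -- `R` is the energy dissipated by the unit current `f₁`, a sum of squares over the positive
      -- number `a`.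
      0≤R : 0# ≤ R
      0≤R = ≤-respʳ-≈ (trans (pair-divergence ψ divergence-f₁) (*-identityˡ R))
        (∑-nonneg gridEdges (λ e → ≤-respʳ-≈ (solve 2 (λ d r → r :* (d :* d) := d :* r :* d) refl (drop ψ e) (a ⁻¹))
          (*-nonneg (<⇒≤ (0<x⇒0<x⁻¹ 0<a)) (square-nonneg (drop ψ e)))))

      -- The choice of b makes ε the equilibrium flow on a chord of latency zero.
      b : Carrier
      b = (- V + ε * R) / gain

      gain*b : gain * b ≈ - V + ε * R
      gain*b = x*[y/x]≈y 0<gain _

      0≤b : 0# ≤ b
      0≤b = *-nonneg (+-nonneg (<⇒≤ (x<0⇒0<-x V<0)) (*-nonneg (<⇒≤ 0<ε) 0≤R)) (<⇒≤ (0<x⇒0<x⁻¹ 0<gain))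

      module Old = OldNetwork b
      module New = NewNetwork b 0# 0#

      g : Maybe GridEdge → Carrier
      g nothing  = ε
      g (just e) = f₀ e - ε * f₁ e

      g-nonneg : ∀ e → 0# ≤ g e
      g-nonneg nothing  = <⇒≤ 0<ε
      g-nonneg (just e) = x≤y⇒0≤y-x (proj₂ (proj₂ scale) 0<ε ≤-refl (gridEdges-complete e))

      g-net : ∀ x → New.netOutflow g x ≈ q * (𝟙 (s ≟ᵥ x) - 𝟙 (t ≟ᵥ x))
      g-net x = begin
        New.netOutflow g x
          ≈⟨ New.∑-edges _ ⟩
        ε * (𝟙 (u ≟ᵥ x) - 𝟙 (v ≟ᵥ x)) + divergence (λ e → f₀ e - ε * f₁ e) x
          ≈⟨ +-congˡ (begin
               divergence (λ e → f₀ e - ε * f₁ e) x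
                 ≈⟨ ∑-cong gridEdges (λ e → solve 4 (λ f ε g i → (f :- ε :* g) :* i := f :* i :- ε :* g :* i) refl (f₀ e) ε (f₁ e) _) ⟩
               _ ≈⟨ ∑-minus gridEdges _ _ ⟩
               divergence f₀ x - divergence (λ e → ε * f₁ e) x
                 ≈⟨ +-cong (divergence-f₀ x) (-‿cong (trans (divergence-scale ε f₁ x) (*-congˡ (divergence-f₁ x)))) ⟩
               q * (𝟙 (s ≟ᵥ x) - 𝟙 (t ≟ᵥ x)) - ε * (1# * (𝟙 (u ≟ᵥ x) - 𝟙 (v ≟ᵥ x))) ∎) ⟩
        ε * (𝟙 (u ≟ᵥ x) - 𝟙 (v ≟ᵥ x)) + (q * (𝟙 (s ≟ᵥ x) - 𝟙 (t ≟ᵥ x)) - ε * (1# * (𝟙 (u ≟ᵥ x) - 𝟙 (v ≟ᵥ x))))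
          ≈⟨ solve 3 (λ ε i j → ε :* i :+ (j :- ε :* (con (+ 1) :* i)) := j) refl ε (𝟙 (u ≟ᵥ x) - 𝟙 (v ≟ᵥ x)) _ ⟩
        q * (𝟙 (s ≟ᵥ x) - 𝟙 (t ≟ᵥ x)) ∎
        where open ≈-Reasoning

      g-feasible : New.IsFeasible g
      g-feasible = New.isFeasible g-nonneg g-net

      -- With a chord that raises the level, the level still ranks the whole network, so `g` can be
      -- decomposed.
      level-<′ : ∀ e → level (Network.tail New.N e) ℕ.< level (Network.head New.N e)
      level-<′ nothing  = level-<ᵘᵛ
      level-<′ (just e) = level-< e

      g-decomposition : ∃[ D ] New.IsDecomposition D g
      g-decomposition = New.Acyclic.decompose level level-<′ (λ _ → z≤n) level-≤-t g-feasible

      -- The old potential less the voltage of the diverted current. By `gain*b` it takes equal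
      -- values at `u` and `v`, as the zero latency of the chord demands.
      π : Vertex → Carrier
      π x = Old.π₀ x - ε * ψ x

      g-latency : ∀ e → Network.latency New.N e (g e) ≈ π (Network.tail New.N e) - π (Network.head New.N e)
      g-latency nothing = begin
        0# * ε + 0#                                ≈⟨ solve 3 (λ ε V R → con (+ 0) :* ε :+ con (+ 0) := V :- ε :* R :+ (:- V :+ ε :* R)) refl ε V R ⟩
        V - ε * R + (- V + ε * R)                  ≈⟨ +-cong (+-congʳ V≈φ) gain*b ⟨
        φ u - φ v - ε * R + gain * b               ≈⟨ solve 8 (λ φu φv ε ψu ψv hu hv b → φu :- φv :- ε :* (ψu :- ψv) :+ (hv :- hu) :* b
                                                        := φu :- b :* hu :- ε :* ψu :- (φv :- b :* hv :- ε :* ψv)) refl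
                                                        (φ u) (φ v) ε (ψ u) (ψ v) (height u) (height v) b ⟩
        π u - π v                                  ∎
        where open ≈-Reasoning
      g-latency (just e) = begin
        a * (f₀ e - ε * f₁ e) + b
          ≈⟨ solve 5 (λ a f ε g b → a :* (f :- ε :* g) :+ b := a :* f :- ε :* (a :* g) :- b :* (:- con (+ 1))) refl a (f₀ e) ε (f₁ e) b ⟩
        a * f₀ e - ε * (a * f₁ e) - b * - 1#
          ≈⟨ +-cong (+-cong (a*f₀≈drop e) (-‿cong (*-congˡ (a*[x/a]≈x (drop ψ e))))) (-‿cong (*-congˡ (sym (drop-height e)))) ⟩
        drop φ e - ε * drop ψ e - b * drop height e
          ≈⟨ solve 8 (λ φu φv ε ψu ψv hu hv b → φu :- φv :- ε :* (ψu :- ψv) :- b :* (hu :- hv)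
               := φu :- b :* hu :- ε :* ψu :- (φv :- b :* hv :- ε :* ψv)) refl
               (φ x) (φ y) ε (ψ x) (ψ y) (height x) (height y) b ⟩
        π x - π y ∎
        where
        open ≈-Reasoning
        x = gridTail e
        y = gridHead e

      g-equilibrium : New.IsUserEquilibrium g × New.cost g ≈ q * (π s - π t)
      g-equilibrium = New.potential-equilibrium π g-feasible (proj₂ g-decomposition) g-latency

      0<cost : 0# < Old.cost f₀
      0<cost = Old.cost-positive 0≤b f₀-positive

      -- Each cost is `q` times a potential difference between `s` and `t`. The `π₀` part is common
      -- to both, which leaves the `ψ` term alone.
      worse : Old.cost f₀ < New.cost g
      worse = 0<y-x⇒x<y (<-respʳ-≈ (begin
        ε * - V                                                    ≈⟨ *-congˡ (-‿cong V≈ψ) ⟩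
        ε * - (q * (ψ s - ψ t))
          ≈⟨ solve 6 (λ ε q ψs ψt ps pt → ε :* (:- (q :* (ψs :- ψt))) := q :* (ps :- ε :* ψs :- (pt :- ε :* ψt)) :- q :* (ps :- pt)) refl
               ε q (ψ s) (ψ t) (Old.π₀ s) (Old.π₀ t) ⟩
        q * (π s - π t) - q * (Old.π₀ s - Old.π₀ t)                ≈⟨ +-cong (proj₂ g-equilibrium) (-‿cong (proj₂ Old.f₀-equilibrium)) ⟨
        New.cost g - Old.cost f₀                                   ∎)
        (*-pos 0<ε (x<0⇒0<-x V<0)))
        where open ≈-Reasoning

      capable : BraessCapable m n a q u v
      capable = b , 0# , 0# , 0≤b , ≤-refl , ≤-refl , New.cost g / Old.cost f₀ ,
        (f₀ , g , proj₁ Old.f₀-equilibrium , proj₁ g-equilibrium , refl) ,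
        *-cancelˡ-< (<⇒≤ 0<cost) (begin-strict
          Old.cost f₀ * 1#                            ≈⟨ *-identityʳ _ ⟩
          Old.cost f₀                                 <⟨ worse ⟩
          New.cost g                                  ≈⟨ x*[y/x]≈y 0<cost (New.cost g) ⟨
          Old.cost f₀ * (New.cost g / Old.cost f₀)    ∎)
        where open ≤-Reasoning

    levelGain-positive⁻¹ : 0ℤ ℤ.< levelGain u v → level u ℕ.< level v
    levelGain-positive⁻¹ 0<k = ℕ.≰⇒> λ v≤u → ℤ.<⇒≱ 0<k
      (≡.subst (levelGain u v ℤ.≤_) (ℤ.n⊖n≡0 (level u)) (ℤ.⊖-monoˡ-≤ (level u) v≤u))

    capable⇔ : BraessCapable m n a q u v ⇔ (V < 0# × 0ℤ ℤ.< levelGain u v)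
    capable⇔ = mk⇔ capable⇒ (λ (V<0 , 0<k) → Backward.capable V<0 (levelGain-positive⁻¹ 0<k))

theorem2p15 : (ℝ : Reals) (let open Reals ℝ) (let open Flow ℝ)
    (m n : ℕ) (let open Grid m n) →
    1 ℕ.≤ m → 1 ℕ.≤ n →
    (a q : Carrier) → 0# < a → 0# < q →
    (L⁺ : Vertex → Vertex → Carrier) →
    IsMoorePenroseInverse m n (laplacian m n a) L⁺ →
    (u v : Vertex) → IsChord u v →
    BraessCapable m n a q u v ⇔ (voltage m n L⁺ q u v < 0# × 0ℤ ℤ.< levelGain u v)
theorem2p15 ℝ m n 1≤m 1≤n a q 0<a 0<q L⁺ mp u v _ = Braess.Chord.capable⇔ ℝ m n 1≤m 1≤n a q 0<a 0<q L⁺ mp u v
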